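{- Let $G$ be an antiferromagnetic weighted graph on vertex set $[n]$ and let $t\ge2$. Then for all $\mathbf{a},\mathbf{b}\in(\mathbb{R}_{\ge0})^n$, \[ V_{K_t}(\mathbf{a},\dots,\mathbf{a};G)\cdot V_{K_t}(\mathbf{b},\dots,\mathbf{b};G)\le \sum_{\phi:[t]\times\{1,2\}\to[n]}\ \prod_{\substack{i,j\in[t]\\ i\ne j}}G(\phi(i,1),\phi(j,2))\prod_{i\in[t]}a_{\phi(i,1)}\,b_{\phi(i,2)}, \] where the right-hand side is the $G$-volume $V_{K_t\times K_2}(\mathbf{a},\dots,\mathbf{a},\mathbf{b},\dots,\mathbf{b};G)$ with $\mathbf{a}$ assigned to the vertices $(i,1)$ and $\mathbf{b}$ to the vertices $(i,2)$ of $K_t\times K_2$.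
   Context: A weighted graph $G$ on $[n]$ is a symmetric matrix with nonnegative entries $G(i,j)$ (loops allowed); it is antiferromagnetic if it has at most one positive eigenvalue, counted with multiplicity. For $\mathbf{x}\in\mathbb{R}^n$, $V_{K_t}(\mathbf{x},\dots,\mathbf{x};G)=\sum_{\phi:[t]\to[n]}\prod_{\{i,j\}\in\binom{[t]}{2}}G(\phi(i),\phi(j))\prod_{s\in[t]}x_{\phi(s)}$. The tensor product $K_t\times K_2$ has vertex set $[t]\times\{1,2\}$ with $(i,1)$ adjacent to $(j,2)$ iff $i\neq j$. -}

module Defs where

open import Algebra.Bundles using (CommutativeRing)
open import Algebra.Core using (Op₁; Op₂)
import Algebra.Definitions as AlgebraDefinitions
open import Algebra.Structures using (IsCommutativeRing)
import Algebra.Properties.CommutativeMonoid.Sum as FiniteSum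
open import Data.Bool.Base using (if_then_else_)
open import Data.Fin.Base using (Fin; zero; suc; finToFun; combine)
open import Data.Fin.Properties using (_<?_; _≟_)
open import Data.Nat.Base as ℕ using (ℕ; suc; _^_)
open import Data.Product.Base using (∃; _×_; _,_; uncurry)
open import Data.Vec.Functional using (Vector)
open import Function.Base using (_∘_)
open import Level using (Level; _⊔_) renaming (suc to lsuc)
open import Relation.Binary.Core using (Rel)
import Relation.Binary.Construct.NonStrictToStrict as ToStrict
open import Relation.Binary.Structures using (IsDecTotalOrder)
open import Relation.Nullary.Decidable using (does)
open import Relation.Nullary.Negation using (¬_)
open import Relation.Unary using (Pred)

-- The real numbers, given by their axiomatic characterisation as a Dedekind
-- complete ordered field (unique up to isomorphism).  The real line is meant
-- classically: the order is decidable and every inhabited predicate that is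
-- bounded above has a supremum.
record CompleteOrderedField (c ℓ₁ ℓ₂ : Level) : Set (lsuc (c ⊔ ℓ₁ ⊔ ℓ₂)) where
  infix  8 -_
  infixl 7 _*_
  infixl 6 _+_
  infix  4 _≈_ _≤_
  field
    Carrier           : Set c
    _≈_               : Rel Carrier ℓ₁
    _≤_               : Rel Carrier ℓ₂
    _+_               : Op₂ Carrier
    _*_               : Op₂ Carrier
    -_                : Op₁ Carrier
    0#                : Carrier
    1#                : Carrier
    isCommutativeRing : IsCommutativeRing _≈_ _+_ _*_ -_ 0# 1#
    isDecTotalOrder   : IsDecTotalOrder _≈_ _≤_

  open AlgebraDefinitions _≈_ using (Invertible)

  UpperBound : Pred Carrier (c ⊔ ℓ₁ ⊔ ℓ₂) → Pred Carrier (c ⊔ ℓ₁ ⊔ ℓ₂)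
  UpperBound P b = ∀ x → P x → x ≤ b

  LeastUpperBound : Pred Carrier (c ⊔ ℓ₁ ⊔ ℓ₂) → Pred Carrier (c ⊔ ℓ₁ ⊔ ℓ₂)
  LeastUpperBound P s = UpperBound P s × (∀ b → UpperBound P b → s ≤ b)

  field
    0≉1               : ¬ (0# ≈ 1#)
    ≉0⇒invertible     : ∀ x → ¬ (x ≈ 0#) → Invertible 1# _*_ x
    +-monoˡ-≤         : ∀ z {x y} → x ≤ y → x + z ≤ y + z
    *-nonneg          : ∀ {x y} → 0# ≤ x → 0# ≤ y → 0# ≤ x * y
    complete          : ∀ (P : Pred Carrier (c ⊔ ℓ₁ ⊔ ℓ₂)) →
                        ∃ P → ∃ (UpperBound P) → ∃ (LeastUpperBound P)

  commutativeRing : CommutativeRing c ℓ₁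
  commutativeRing = record { isCommutativeRing = isCommutativeRing }

  open ToStrict _≈_ _≤_ public using (_<_)

module WeightedGraphs {c ℓ₁ ℓ₂ : Level} (ℝ : CompleteOrderedField c ℓ₁ ℓ₂) where

  open CompleteOrderedField ℝ
  open CommutativeRing commutativeRing
    using (+-commutativeMonoid; *-commutativeMonoid)
  open FiniteSum +-commutativeMonoid public using (sum)
  open FiniteSum *-commutativeMonoid public using () renaming (sum to product)

  Matrix : ℕ → Set c
  Matrix n = Fin n → Fin n → Carrier

  InEigenspace : ∀ {n} → Matrix n → Carrier → Vector Carrier n → Set ℓ₁
  InEigenspace A λ′ v = ∀ i → sum (λ j → A i j * v j) ≈ λ′ * v i

  Eigenvalue : ∀ {n} → Matrix n → Carrier → Set (c ⊔ ℓ₁)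
  Eigenvalue {n} A λ′ = ∃ λ (v : Vector Carrier n) → (∃ λ i → ¬ (v i ≈ 0#)) × InEigenspace A λ′ v

  LinearlyDependent : ∀ {k n} → (Fin k → Vector Carrier n) → Set (c ⊔ ℓ₁)
  LinearlyDependent {k} v = ∃ λ (α : Vector Carrier k) →
    (∃ λ s → ¬ (α s ≈ 0#)) × (∀ i → sum (λ s → α s * v s i) ≈ 0#)

  -- The eigenspace has dimension at most k.  For the symmetric matrices
  -- considered here this dimension is also the algebraic multiplicity.
  MultiplicityAtMost : ∀ {n} → ℕ → Matrix n → Carrier → Set (c ⊔ ℓ₁)
  MultiplicityAtMost {n} k A λ′ = ∀ (v : Fin (suc k) → Vector Carrier n) →
    (∀ s → InEigenspace A λ′ (v s)) → LinearlyDependent v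

  -- The multiplicities of the positive eigenvalues add up to at most 1:
  -- there is at most one such eigenvalue, and it is simple.
  AtMostOnePositiveEigenvalue : ∀ {n} → Matrix n → Set (c ⊔ ℓ₁ ⊔ ℓ₂)
  AtMostOnePositiveEigenvalue A =
    (∀ {λ′ μ} → 0# < λ′ → Eigenvalue A λ′ →
                0# < μ  → Eigenvalue A μ  → λ′ ≈ μ) ×
    (∀ {λ′} → 0# < λ′ → Eigenvalue A λ′ → MultiplicityAtMost 1 A λ′)

  record WeightedGraph (n : ℕ) : Set (c ⊔ ℓ₁ ⊔ ℓ₂) where
    field
      weight    : Matrix n
      symmetric : ∀ i j → weight i j ≈ weight j i
      nonneg    : ∀ i j → 0# ≤ weight i j

  open WeightedGraph public

  Antiferromagnetic : ∀ {n} → WeightedGraph n → Set (c ⊔ ℓ₁ ⊔ ℓ₂)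
  Antiferromagnetic G = AtMostOnePositiveEigenvalue (weight G)

  -- finToFun enumerates the n ^ m maps Fin m → Fin n without repetition.
  sumOverMaps : ∀ {m n} → ((Fin m → Fin n) → Carrier) → Carrier
  sumOverMaps {m} {n} F = sum {n ^ m} (λ k → F (finToFun k))

  -- combine is the bijection from Fin m × Fin k to Fin (m * k).
  sumOverMaps× : ∀ {m k n} → ((Fin m × Fin k → Fin n) → Carrier) → Carrier
  sumOverMaps× {m} {k} F = sumOverMaps {m ℕ.* k} (λ ψ → F (ψ ∘ uncurry combine))

  -- Since weights are symmetric, an unordered pair {i , j} is taken as i < j.
  V-K : ∀ {n} (t : ℕ) → WeightedGraph n → Vector Carrier n → Carrier
  V-K {n} t G x = sumOverMaps λ (φ : Fin t → Fin n) →
      product (λ i → product λ j →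
        if does (i <? j) then weight G (φ i) (φ j) else 1#)
    * product (λ s → x (φ s))

  -- The elements zero and suc zero of Fin 2 play the roles of 1 and 2 in the
  -- vertex set [t] × {1 , 2} of the tensor product K_t × K_2.
  V-K×K₂ : ∀ {n} (t : ℕ) → WeightedGraph n →
           Vector Carrier n → Vector Carrier n → Carrier
  V-K×K₂ {n} t G a b = sumOverMaps× λ (φ : Fin t × Fin 2 → Fin n) →
      product (λ i → product λ j →
        if does (i ≟ j) then 1# else weight G (φ (i , zero)) (φ (j , suc zero)))
    * product (λ i → a (φ (i , zero)) * b (φ (i , suc zero)))

{-# OPTIONS --safe #-}
module Submission where

-- Write H(B) for the Alexandrov–Fenchel inequality B(x,x) B(y,y) ≤ B(x,y)²,
-- for all x and all y ≥ 0.  An antiferromagnetic G satisfies H: otherwise a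
-- plane on which G is positive definite would contribute a second positive
-- eigenvector, orthogonal to the first one.
--
-- Perturbing G to (I + εJ) G (I + εJ) one may assume that G > 0.  Then every
-- form T_p(x,y) = V(p,x,y,…) obtained from the K_t-volume satisfies H, by
-- induction on the number of fixed vectors: for p = e_k it is a form of the
-- smaller clique, and H passes to sums because T_p and T_q are nonpositive on
-- the kernel of the common functional T_p(q,·) = T_q(p,·).  Hence the sequence
-- V(aᵏ,bᵗ⁻ᵏ) is log-concave, and V(aᵗ) V(bᵗ) ≤ V(aᵗ⁻¹,b) V(a,bᵗ⁻¹).  Fixing
-- the odd vertex w of the first clique and u of the second, the induction
-- hypothesis for t - 1 applies to the vectors a · G(w,·) and b · G(u,·).

open import Defs
open import Algebra.Bundles using (CommutativeRing)
import Algebra.Properties.AbelianGroup as AbelianGroupProperties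
import Algebra.Properties.CommutativeMonoid.Sum as FiniteSum
import Algebra.Properties.Ring as RingProperties
import Algebra.Properties.Semiring.Mult.TCOptimised as Multiples
import Algebra.Properties.Semiring.Sum as SemiringSum
import Algebra.Solver.Ring as RingSolver
open import Algebra.Solver.Ring.AlmostCommutativeRing
  using (_-Raw-AlmostCommutative⟶_; fromCommutativeRing)
open import Data.Bool.Base using (if_then_else_)
open import Data.Empty using (⊥; ⊥-elim)
open import Data.Fin.Base using (Fin; zero; suc; finToFun; combine; _↑ˡ_; _↑ʳ_)
open import Data.Fin.Properties using (_<?_; remQuot-combine) renaming (_≟_ to _≟ᶠ_)
open import Data.Integer.Base as ℤ using (ℤ; +_; -[1+_]; _⊖_)
import Data.Integer.Properties as ℤₚ
open import Data.List.Base using (List; []; _∷_; _++_; replicate)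
open import Data.List.Properties using (++-identityʳ)
open import Data.List.Relation.Unary.All using (All; []; _∷_)
import Data.List.Relation.Unary.All.Properties as All
open import Data.Maybe.Base using (Maybe; map)
open import Data.Nat.Base as ℕ using (ℕ; zero; suc; _^_)
import Data.Nat.Properties as ℕₚ
open import Data.Product.Base using (∃; _×_; _,_; proj₁; proj₂; uncurry)
open import Data.Sum.Base as Sum using (_⊎_; inj₁; inj₂; [_,_]′)
open import Data.Vec.Functional using (Vector) renaming (_∷_ to cons)
open import Function.Base using (_∘_)
open import Level using (Level; _⊔_)
open import Relation.Binary.PropositionalEquality.Core as ≡ using (_≡_)
import Relation.Binary.Reasoning.Setoid as SetoidReasoning
open import Relation.Binary.Structures using (IsDecTotalOrder)
open import Relation.Nullary.Decidable using (yes; no; does; dec⇒maybe)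
open import Relation.Nullary.Negation using (¬_)

-- Degeneracy is the obstacle that shapes the proof. Chaining the log-concavity inequalities cancels
-- mixed volumes, and the passage of H to sums needs the common functional to be nonzero at y; both
-- break down when volumes vanish, as they may in a graph with missing edges. Congruence by I + εJ
-- repairs this and keeps H, because I + εJ maps nonnegative vectors to nonnegative ones, whereas
-- adding εJ to G could create a second positive eigenvalue. The left-hand side is monotone in the
-- weights, so letting ε tend to 0 takes only an upper estimate of the right-hand side. The
-- eigenvectors are obtained from completeness of the field alone. A supremum of Rayleigh quotients
-- supplies the eigenvalue; that it is attained follows, in place of compactness of the sphere, from
-- symmetric Gaussian elimination on a semidefinite form.

-- Ring normalisation with integer coefficients

module IntegerRingSolver {c ℓ} (R : CommutativeRing c ℓ) where

  open CommutativeRing R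
  open RingProperties ring using (-0#≈0#; -‿distribˡ-*)
  open AbelianGroupProperties +-abelianGroup using (⁻¹-involutive; ⁻¹-∙-comm)
  open Multiples semiring using (1+×; ×-homo-+; ×1-homo-*) renaming (_×_ to _·_)
  open SetoidReasoning setoid

  private
    -- With this version of multiples, `1 · 1#` reduces to `1#`, so that `con (+ 1)` in a solver
    -- equation denotes `1#` itself.
    ι : ℤ → Carrier
    ι (+ n)      = n · 1#
    ι (-[1+ n ]) = - (suc n · 1#)

    ι-⊖ : ∀ m n → ι (m ⊖ n) ≈ m · 1# - n · 1#
    ι-⊖ m       zero    = sym (trans (+-congˡ -0#≈0#) (+-identityʳ _))
    ι-⊖ zero    (suc n) = sym (+-identityˡ _)
    ι-⊖ (suc m) (suc n) = begin
      ι (suc m ⊖ suc n)                   ≡⟨ ≡.cong ι (ℤₚ.[1+m]⊖[1+n]≡m⊖n m n) ⟩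
      ι (m ⊖ n)                           ≈⟨ ι-⊖ m n ⟩
      m · 1# - n · 1#                     ≈⟨ +-congʳ (+-identityˡ _) ⟨
      0# + m · 1# - n · 1#                ≈⟨ +-congʳ (+-congʳ (-‿inverseʳ 1#)) ⟨
      1# - 1# + m · 1# - n · 1#           ≈⟨ +-congʳ (+-assoc _ _ _) ⟩
      1# + (- 1# + m · 1#) - n · 1#       ≈⟨ +-congʳ (+-congˡ (+-comm _ _)) ⟩
      1# + (m · 1# - 1#) - n · 1#         ≈⟨ +-congʳ (+-assoc _ _ _) ⟨
      1# + m · 1# - 1# - n · 1#           ≈⟨ +-assoc _ _ _ ⟩
      1# + m · 1# + (- 1# - n · 1#)       ≈⟨ +-cong (sym (1+× m 1#)) (trans (⁻¹-∙-comm _ _) (-‿cong (sym (1+× n 1#)))) ⟩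
      suc m · 1# - suc n · 1#             ∎

    ι-neg : ∀ i → ι (ℤ.- i) ≈ - ι i
    ι-neg (+ zero)   = sym -0#≈0#
    ι-neg (+ suc n)  = refl
    ι-neg (-[1+ n ]) = sym (⁻¹-involutive _)

    ι-+ : ∀ i j → ι (i ℤ.+ j) ≈ ι i + ι j
    ι-+ (+ m)      (+ n)      = ×-homo-+ 1# m n
    ι-+ (+ m)      (-[1+ n ]) = ι-⊖ m (suc n)
    ι-+ (-[1+ m ]) (+ n)      = trans (ι-⊖ n (suc m)) (+-comm _ _)
    ι-+ (-[1+ m ]) (-[1+ n ]) = begin
      - (suc (suc (m ℕ.+ n)) · 1#)      ≈⟨ -‿cong (1+× (suc (m ℕ.+ n)) 1#) ⟩
      - (1# + (suc m ℕ.+ n) · 1#)       ≈⟨ -‿cong (+-congˡ (×-homo-+ 1# (suc m) n)) ⟩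
      - (1# + (suc m · 1# + n · 1#))    ≈⟨ -‿cong (trans (sym (+-assoc _ _ _)) (trans (+-congʳ (+-comm _ _)) (+-assoc _ _ _))) ⟩
      - (suc m · 1# + (1# + n · 1#))    ≈⟨ -‿cong (+-congˡ (1+× n 1#)) ⟨
      - (suc m · 1# + suc n · 1#)       ≈⟨ ⁻¹-∙-comm _ _ ⟨
      - (suc m · 1#) - suc n · 1#       ∎

    ι-*-pos : ∀ m j → ι (+ m ℤ.* j) ≈ ι (+ m) * ι j
    ι-*-pos m (+ n) = begin
      ι (+ m ℤ.* + n)     ≡⟨ ≡.cong ι (ℤₚ.pos-* m n) ⟨
      (m ℕ.* n) · 1#      ≈⟨ ×1-homo-* m n ⟩
      m · 1# * (n · 1#)   ∎
    ι-*-pos m (-[1+ n ]) = begin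
      ι (+ m ℤ.* ℤ.- (+ suc n))  ≡⟨ ≡.cong ι (ℤₚ.neg-distribʳ-* (+ m) (+ suc n)) ⟨
      ι (ℤ.- (+ m ℤ.* + suc n))  ≈⟨ ι-neg (+ m ℤ.* + suc n) ⟩
      - ι (+ m ℤ.* + suc n)      ≈⟨ -‿cong (ι-*-pos m (+ suc n)) ⟩
      - (m · 1# * (suc n · 1#))  ≈⟨ RingProperties.-‿distribʳ-* ring _ _ ⟩
      m · 1# * - (suc n · 1#)    ∎

    ι-* : ∀ i j → ι (i ℤ.* j) ≈ ι i * ι j
    ι-* (+ m)      j = ι-*-pos m j
    ι-* (-[1+ m ]) j = begin
      ι (ℤ.- (+ suc m) ℤ.* j)    ≡⟨ ≡.cong ι (ℤₚ.neg-distribˡ-* (+ suc m) j) ⟨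
      ι (ℤ.- (+ suc m ℤ.* j))    ≈⟨ ι-neg (+ suc m ℤ.* j) ⟩
      - ι (+ suc m ℤ.* j)        ≈⟨ -‿cong (ι-*-pos (suc m) j) ⟩
      - (suc m · 1# * ι j)       ≈⟨ -‿distribˡ-* _ _ ⟩
      - (suc m · 1#) * ι j       ∎

    homomorphism : ℤ.+-*-rawRing -Raw-AlmostCommutative⟶ fromCommutativeRing R
    homomorphism = record
      { ⟦_⟧    = ι
      ; +-homo = ι-+
      ; *-homo = ι-*
      ; -‿homo = ι-neg
      ; 0-homo = refl
      ; 1-homo = refl
      }

    -- Distinct integers may have equal images in an arbitrary ring, so only a positive answer is
    -- ever given.
    ι-dec : ∀ i j → Maybe (ι i ≈ ι j)
    ι-dec i j = map (λ { ≡.refl → refl }) (dec⇒maybe (i ℤₚ.≟ j))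

  open RingSolver ℤ.+-*-rawRing (fromCommutativeRing R) homomorphism ι-dec public
    using (solve; _:=_; _:+_; _:*_; _:-_; :-_; con)

-- Arithmetic of ordered fields

module OrderedField {c ℓ₁ ℓ₂} (ℝ : CompleteOrderedField c ℓ₁ ℓ₂) where

  open CompleteOrderedField ℝ public
  open CommutativeRing commutativeRing public
    using ( _-_; refl; reflexive; sym; trans; setoid; semiring; ring
          ; +-cong; +-congˡ; +-congʳ; *-cong; *-congˡ; *-congʳ; -‿cong
          ; +-identityˡ; +-identityʳ; *-identityˡ; *-identityʳ; zeroˡ; zeroʳ
          ; +-comm; *-comm; +-assoc; *-assoc; -‿inverseʳ
          ; *-commutativeMonoid)
  open IsDecTotalOrder isDecTotalOrder public
    using (_≟_; _≤?_; total; antisym)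
    renaming (refl to ≤-refl; reflexive to ≤-reflexive; trans to ≤-trans)
  open IntegerRingSolver commutativeRing public
  open RingProperties ring public using (-0#≈0#)

  private variable
    x y z u v w : Carrier

  ≤-resp : x ≈ y → u ≈ v → x ≤ u → y ≤ v
  ≤-resp p q h = ≤-trans (≤-reflexive (sym p)) (≤-trans h (≤-reflexive q))

  0≤-resp : x ≈ y → 0# ≤ x → 0# ≤ y
  0≤-resp p h = ≤-trans h (≤-reflexive p)

  <-resp : x ≈ y → u ≈ v → x < u → y < v
  <-resp p q (h , n) = ≤-resp p q h , λ e → n (trans p (trans e (sym q)))

  ≰⇒> : ¬ (x ≤ y) → y < x
  ≰⇒> {x} {y} n with total x y
  ... | inj₁ h = ⊥-elim (n h)
  ... | inj₂ h = h , λ e → n (≤-reflexive (sym e))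

  <⇒≱ : x < y → ¬ (y ≤ x)
  <⇒≱ (h , n) k = n (antisym h k)

  ≤∧≉0⇒0< : 0# ≤ x → ¬ (x ≈ 0#) → 0# < x
  ≤∧≉0⇒0< h n = h , λ e → n (sym e)

  0≤⇒≈0⊎0< : 0# ≤ x → (x ≈ 0#) ⊎ (0# < x)
  0≤⇒≈0⊎0< {x} h with x ≟ 0#
  ... | yes e = inj₁ e
  ... | no n  = inj₂ (≤∧≉0⇒0< h n)

  0≤y-x⇒x≤y : 0# ≤ y - x → x ≤ y
  0≤y-x⇒x≤y {y} {x} h = ≤-resp (+-identityˡ x)
    (solve 2 (λ x y → (y :- x) :+ x := y) refl x y) (+-monoˡ-≤ x h)

  x≤y⇒0≤y-x : x ≤ y → 0# ≤ y - x
  x≤y⇒0≤y-x {x} {y} h = ≤-resp (-‿inverseʳ x) refl (+-monoˡ-≤ (- x) h)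

  ≤-cert : y - x ≈ z → 0# ≤ z → x ≤ y
  ≤-cert e h = 0≤y-x⇒x≤y (0≤-resp (sym e) h)

  +-mono-≤ : x ≤ y → u ≤ v → x + u ≤ y + v
  +-mono-≤ {x} {y} {u} {v} p q = ≤-trans (+-monoˡ-≤ u p)
    (≤-resp (+-comm u y) (+-comm v y) (+-monoˡ-≤ y q))

  +-nonneg : 0# ≤ x → 0# ≤ y → 0# ≤ x + y
  +-nonneg p q = ≤-resp (+-identityˡ 0#) refl (+-mono-≤ p q)

  0<x+y : 0# < x → 0# ≤ y → 0# < x + y
  0<x+y {x} {y} p q = +-nonneg (proj₁ p) q , λ e → <⇒≱ p
    (≤-cert (trans (+-congʳ e) (solve 2 (λ x y → (x :+ y) :- x := y) refl x y)) q)

  square-nonneg : ∀ x → 0# ≤ x * x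
  square-nonneg x with total 0# x
  ... | inj₁ h = *-nonneg h h
  ... | inj₂ h = 0≤-resp (solve 1 (λ x → (con (+ 0) :- x) :* (con (+ 0) :- x) := x :* x) refl x)
                         (*-nonneg (x≤y⇒0≤y-x h) (x≤y⇒0≤y-x h))

  0≤1 : 0# ≤ 1#
  0≤1 = 0≤-resp (*-identityˡ 1#) (square-nonneg 1#)

  0<1 : 0# < 1#
  0<1 = 0≤1 , 0≉1

  *-monoˡ-≤ : 0# ≤ z → x ≤ y → z * x ≤ z * y
  *-monoˡ-≤ {z} {x} {y} p q = ≤-cert
    (solve 3 (λ z x y → z :* y :- z :* x := z :* (y :- x)) refl z x y)
    (*-nonneg p (x≤y⇒0≤y-x q))

  *-mono-≤ : 0# ≤ x → 0# ≤ u → x ≤ y → u ≤ v → x * u ≤ y * v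
  *-mono-≤ {x} {u} {y} {v} 0≤x 0≤u p q = ≤-trans (*-monoˡ-≤ 0≤x q)
    (≤-resp (*-comm v x) (*-comm v y) (*-monoˡ-≤ (≤-trans 0≤u q) p))

  x*y≈0⇒y≈0 : ¬ (x ≈ 0#) → x * y ≈ 0# → y ≈ 0#
  x*y≈0⇒y≈0 {x} {y} n e with ≉0⇒invertible x n
  ... | x⁻¹ , l , _ = begin
    y               ≈⟨ *-identityˡ y ⟨
    1# * y          ≈⟨ *-congʳ l ⟨
    x⁻¹ * x * y     ≈⟨ *-assoc _ _ _ ⟩
    x⁻¹ * (x * y)   ≈⟨ *-congˡ e ⟩
    x⁻¹ * 0#        ≈⟨ zeroʳ x⁻¹ ⟩
    0#              ∎
    where open SetoidReasoning setoid

  x*x≈0⇒x≈0 : x * x ≈ 0# → x ≈ 0#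
  x*x≈0⇒x≈0 {x} e with x ≟ 0#
  ... | yes p = p
  ... | no n  = x*y≈0⇒y≈0 n e

  0<x⇒x≉0 : 0# < x → ¬ (x ≈ 0#)
  0<x⇒x≉0 (_ , n) e = n (sym e)

  *-pos : 0# < x → 0# < y → 0# < x * y
  *-pos p q = ≤∧≉0⇒0< (*-nonneg (proj₁ p) (proj₁ q))
    λ e → 0<x⇒x≉0 q (x*y≈0⇒y≈0 (0<x⇒x≉0 p) e)

  square-pos : ¬ (x ≈ 0#) → 0# < x * x
  square-pos {x} n = ≤∧≉0⇒0< (square-nonneg x) λ e → n (x*x≈0⇒x≈0 e)

  *-cancelˡ-≤ : 0# < z → z * x ≤ z * y → x ≤ y
  *-cancelˡ-≤ {z} {x} {y} p h with x ≤? y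
  ... | yes q = q
  ... | no q  = ⊥-elim (<⇒≱ (*-pos p 0<x-y) (≤-resp
      (solve 3 (λ x y z → (z :* x) :- (z :* y) := z :* (x :- y)) refl x y z)
      (-‿inverseʳ (z * y)) (+-monoˡ-≤ (- (z * y)) h)))
    where
    0<x-y : 0# < x - y
    0<x-y = x≤y⇒0≤y-x (proj₁ (≰⇒> q)) , λ e → q (≤-reflexive
      (trans (solve 2 (λ x y → x := y :+ (x :- y)) refl x y)
             (trans (+-congˡ (sym e)) (+-identityʳ y))))

  inverse : 0# < x → ∃ λ y → 0# < y × x * y ≈ 1#
  inverse {x} p with ≉0⇒invertible x (0<x⇒x≉0 p)
  ... | y , _ , r = y , 0<y , r
    where
    0<y : 0# < y
    0<y = *-cancelˡ-≤ p (≤-resp (sym (zeroʳ x)) (sym r) 0≤1) ,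
          λ e → 0≉1 (trans (sym (trans (*-congˡ (sym e)) (zeroʳ x))) r)

  ≤-by-contradiction : ∀ {x y} → (y < x → ⊥) → x ≤ y
  ≤-by-contradiction {x} {y} h with x ≤? y
  ... | yes p = p
  ... | no ¬p = ⊥-elim (h (≰⇒> ¬p))

  x<y⇒0<y-x : ∀ {x y} → x < y → 0# < y - x
  x<y⇒0<y-x {x} {y} (h , ne) = x≤y⇒0≤y-x h , λ e → ne
    (trans (sym (+-identityʳ x)) (trans (+-congˡ e) (solve 2 (λ x y → x :+ (y :- x) := y) refl x y)))

  -- Expanding a square bounds twice a product; this drops the factor two without dividing.
  x+x≤y⇒x≤y : ∀ {x y} → 0# ≤ y → x + x ≤ y → x ≤ y
  x+x≤y⇒x≤y {x} {y} 0≤y h with total x 0#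
  ... | inj₁ x≤0 = ≤-trans x≤0 0≤y
  ... | inj₂ 0≤x = ≤-trans (≤-resp (+-identityˡ x) refl (+-monoˡ-≤ x 0≤x)) h

  -- Provides x² + 2 as a nonnegative majorant of a constant x of unknown sign, in place of an
  -- absolute value.
  x+x≤x²+2 : ∀ x → x + x ≤ x * x + 1# + 1#
  x+x≤x²+2 x = ≤-cert
    (solve 1 (λ x → (x :* x :+ con (+ 1) :+ con (+ 1)) :- (x :+ x)
                := (x :- con (+ 1)) :* (x :- con (+ 1)) :+ con (+ 1)) refl x)
    (+-nonneg (square-nonneg (x - 1#)) 0≤1)

-- Finite sums and the order

module FiniteSums {c ℓ₁ ℓ₂} (ℝ : CompleteOrderedField c ℓ₁ ℓ₂) where

  open OrderedField ℝ
  open WeightedGraphs ℝ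
  open SemiringSum semiring public
    using (∑-distrib-+; ∑-comm; *-distribˡ-sum; *-distribʳ-sum; sum-replicate-zero)

  sum-cong : ∀ {n} {f g : Vector Carrier n} → (∀ i → f i ≈ g i) → sum f ≈ sum g
  sum-cong {zero}  h = refl
  sum-cong {suc n} h = +-cong (h zero) (sum-cong (h ∘ suc))

  sum-zero : ∀ {n} {f : Vector Carrier n} → (∀ i → f i ≈ 0#) → sum f ≈ 0#
  sum-zero {n} h = trans (sum-cong h) (sum-replicate-zero n)

  sum-mono : ∀ {n} {f g : Vector Carrier n} → (∀ i → f i ≤ g i) → sum f ≤ sum g
  sum-mono {zero}  h = ≤-refl
  sum-mono {suc n} h = +-mono-≤ (h zero) (sum-mono (h ∘ suc))

  sum-nonneg : ∀ {n} {f : Vector Carrier n} → (∀ i → 0# ≤ f i) → 0# ≤ sum f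
  sum-nonneg {zero}  h = ≤-refl
  sum-nonneg {suc n} h = +-nonneg (h zero) (sum-nonneg (h ∘ suc))

  term≤sum : ∀ {n} {f : Vector Carrier n} → (∀ i → 0# ≤ f i) → ∀ i → f i ≤ sum f
  term≤sum h zero    = ≤-resp (+-identityʳ _) refl (+-mono-≤ ≤-refl (sum-nonneg (h ∘ suc)))
  term≤sum h (suc i) = ≤-resp (+-identityˡ _) refl (+-mono-≤ (h zero) (term≤sum (h ∘ suc) i))

  sum-pos : ∀ {n} {f : Vector Carrier n} → (∀ i → 0# ≤ f i) → ∀ i → 0# < f i → 0# < sum f
  sum-pos h i p = sum-nonneg h , λ e → <⇒≱ p (≤-trans (term≤sum h i) (≤-reflexive (sym e)))

-- Bilinear forms of symmetric matrices

module SpectralTheory {c ℓ₁ ℓ₂} (ℝ : CompleteOrderedField c ℓ₁ ℓ₂) where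

  open OrderedField ℝ
  open WeightedGraphs ℝ
  open FiniteSums ℝ

  private variable
    n : ℕ

  Symmetric : Matrix n → Set ℓ₁
  Symmetric A = ∀ i j → A i j ≈ A j i

  Nonzero : Vector Carrier n → Set ℓ₁
  Nonzero v = ∃ λ i → ¬ (v i ≈ 0#)

  dot : Vector Carrier n → Vector Carrier n → Carrier
  dot x y = sum (λ i → x i * y i)

  infixr 7 _▷_
  _▷_ : Matrix n → Vector Carrier n → Vector Carrier n
  (A ▷ x) i = dot (A i) x

  bil : Matrix n → Vector Carrier n → Vector Carrier n → Carrier
  bil A x y = dot x (A ▷ y)

  combination : Carrier → Vector Carrier n → Carrier → Vector Carrier n → Vector Carrier n
  combination s x t y i = s * x i + t * y i

  PositiveSemidefinite : Matrix n → Set (c ⊔ ℓ₂)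
  PositiveSemidefinite A = ∀ x → 0# ≤ bil A x x

  dot-cong : ∀ {x x′ y y′ : Vector Carrier n} →
             (∀ i → x i ≈ x′ i) → (∀ i → y i ≈ y′ i) → dot x y ≈ dot x′ y′
  dot-cong p q = sum-cong λ i → *-cong (p i) (q i)

  dot-comm : ∀ (x y : Vector Carrier n) → dot x y ≈ dot y x
  dot-comm x y = sum-cong λ i → *-comm (x i) (y i)

  dot-combinationʳ : ∀ (z : Vector Carrier n) s x t y →
                     dot z (combination s x t y) ≈ s * dot z x + t * dot z y
  dot-combinationʳ z s x t y = begin
    dot z (combination s x t y)
      ≈⟨ sum-cong (λ i → solve 5 (λ z s x t y → z :* (s :* x :+ t :* y) := s :* (z :* x) :+ t :* (z :* y))
                          refl (z i) s (x i) t (y i)) ⟩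
    sum (λ i → s * (z i * x i) + t * (z i * y i))
      ≈⟨ ∑-distrib-+ (λ i → s * (z i * x i)) (λ i → t * (z i * y i)) ⟩
    sum (λ i → s * (z i * x i)) + sum (λ i → t * (z i * y i))
      ≈⟨ +-cong (*-distribˡ-sum s (λ i → z i * x i)) (*-distribˡ-sum t (λ i → z i * y i)) ⟨
    s * dot z x + t * dot z y ∎
    where open SetoidReasoning setoid

  dot-combinationˡ : ∀ s (x : Vector Carrier n) t y z →
                     dot (combination s x t y) z ≈ s * dot x z + t * dot y z
  dot-combinationˡ s x t y z = trans (dot-comm _ z) (trans (dot-combinationʳ z s x t y)
    (+-cong (*-congˡ (dot-comm z x)) (*-congˡ (dot-comm z y))))

  dot-scaleʳ : ∀ (x : Vector Carrier n) s y → dot x (λ i → s * y i) ≈ s * dot x y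
  dot-scaleʳ x s y = trans
    (sum-cong λ i → solve 3 (λ x s y → x :* (s :* y) := s :* (x :* y)) refl (x i) s (y i))
    (sym (*-distribˡ-sum s (λ i → x i * y i)))

  dot-scaleˡ : ∀ s (x : Vector Carrier n) y → dot (λ i → s * x i) y ≈ s * dot x y
  dot-scaleˡ s x y = trans (dot-comm _ y) (trans (dot-scaleʳ y s x) (*-congˡ (dot-comm y x)))

  dot-zeroʳ : ∀ (x : Vector Carrier n) → dot x (λ _ → 0#) ≈ 0#
  dot-zeroʳ x = sum-zero λ i → zeroʳ (x i)

  dot-zeroˡ : ∀ (x : Vector Carrier n) → dot (λ _ → 0#) x ≈ 0#
  dot-zeroˡ x = sum-zero λ i → zeroˡ (x i)

  dot-nonneg : ∀ (x : Vector Carrier n) → 0# ≤ dot x x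
  dot-nonneg x = sum-nonneg λ i → square-nonneg (x i)

  dot-pos : ∀ {x : Vector Carrier n} → Nonzero x → 0# < dot x x
  dot-pos {x = x} (i , nz) = sum-pos (λ i → square-nonneg (x i)) i (square-pos nz)

  dot-definite : ∀ {x : Vector Carrier n} → dot x x ≈ 0# → ∀ i → x i ≈ 0#
  dot-definite {x = x} e i with x i ≟ 0#
  ... | yes p = p
  ... | no nz = ⊥-elim (0<x⇒x≉0 (dot-pos (i , nz)) e)

  bil-combinationʳ : ∀ (A : Matrix n) z s x t y →
                     bil A z (combination s x t y) ≈ s * bil A z x + t * bil A z y
  bil-combinationʳ A z s x t y = trans
    (dot-cong (λ _ → refl) λ i → dot-combinationʳ (A i) s x t y)
    (dot-combinationʳ z s (A ▷ x) t (A ▷ y))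

  bil-sym : ∀ {A : Matrix n} → Symmetric A → ∀ x y → bil A x y ≈ bil A y x
  bil-sym {A = A} symA x y = begin
    sum (λ i → x i * sum (λ j → A i j * y j))
      ≈⟨ sum-cong (λ i → *-distribˡ-sum (x i) (λ j → A i j * y j)) ⟩
    sum (λ i → sum (λ j → x i * (A i j * y j)))
      ≈⟨ ∑-comm (λ i j → x i * (A i j * y j)) ⟩
    sum (λ j → sum (λ i → x i * (A i j * y j)))
      ≈⟨ sum-cong (λ j → sum-cong λ i → trans (*-congˡ (*-congʳ (symA i j)))
           (solve 3 (λ x a y → x :* (a :* y) := y :* (a :* x)) refl (x i) (A j i) (y j))) ⟩
    sum (λ j → sum (λ i → y j * (A j i * x i)))
      ≈⟨ sum-cong (λ j → *-distribˡ-sum (y j) (λ i → A j i * x i)) ⟨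
    sum (λ j → y j * sum (λ i → A j i * x i)) ∎
    where open SetoidReasoning setoid

  bil-combination : ∀ {A : Matrix n} → Symmetric A → ∀ s x t y →
    bil A (combination s x t y) (combination s x t y) ≈
    s * s * bil A x x + (s * t * bil A x y + s * t * bil A x y) + t * t * bil A y y
  bil-combination {A = A} symA s x t y = begin
    bil A w w
      ≈⟨ bil-combinationʳ A w s x t y ⟩
    s * bil A w x + t * bil A w y
      ≈⟨ +-cong (*-congˡ (trans (bil-sym symA w x) (bil-combinationʳ A x s x t y)))
                (*-congˡ (trans (bil-sym symA w y) (bil-combinationʳ A y s x t y))) ⟩
    s * (s * bil A x x + t * bil A x y) + t * (s * bil A y x + t * bil A y y)
      ≈⟨ +-congˡ (*-congˡ (+-congʳ (*-congˡ (bil-sym symA y x)))) ⟩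
    s * (s * bil A x x + t * bil A x y) + t * (s * bil A x y + t * bil A y y)
      ≈⟨ solve 5 (λ s t a b c → s :* (s :* a :+ t :* b) :+ t :* (s :* b :+ t :* c)
                    := s :* s :* a :+ (s :* t :* b :+ s :* t :* b) :+ t :* t :* c)
                 refl s t (bil A x x) (bil A x y) (bil A y y) ⟩
    s * s * bil A x x + (s * t * bil A x y + s * t * bil A x y) + t * t * bil A y y ∎
    where
    open SetoidReasoning setoid
    w = combination s x t y

  -- Entry by entry, twice x_i A_ij x_j is at most x_i² + A_ij² x_j², hence at most (1 + A_ij²)
  -- times `dot x x`; these bounds are summed.
  bil-bounded : ∀ (A : Matrix n) → ∃ λ C → ∀ x → bil A x x ≤ C * dot x x
  bil-bounded A = sum (λ i → sum (λ j → C i j)) , λ x → ≤-resp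
      (sum-cong λ i → sym (*-distribˡ-sum (x i) (λ j → A i j * x j)))
      (trans (sum-cong λ i → sym (*-distribʳ-sum (dot x x) (C i))) (sym (*-distribʳ-sum (dot x x) (λ i → sum (C i)))))
      (sum-mono λ i → sum-mono λ j → entry x i j)
    where
    C : Matrix _
    C i j = 1# + A i j * A i j
    square≤dot : ∀ x i → x i * x i ≤ dot x x
    square≤dot x = term≤sum (λ i → square-nonneg (x i))
    entry : ∀ x i j → x i * (A i j * x j) ≤ C i j * dot x x
    entry x i j = x+x≤y⇒x≤y
      (*-nonneg (+-nonneg 0≤1 (square-nonneg (A i j))) (dot-nonneg x))
      (≤-trans
        (≤-cert (solve 3 (λ x a y → (x :* x :+ a :* a :* (y :* y)) :- (x :* (a :* y) :+ x :* (a :* y))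
                            := (x :- a :* y) :* (x :- a :* y)) refl (x i) (A i j) (x j))
                (square-nonneg (x i - A i j * x j)))
        (≤-resp refl (solve 2 (λ d a → d :+ a :* a :* d := (con (+ 1) :+ a :* a) :* d) refl (dot x x) (A i j))
          (+-mono-≤ (square≤dot x i) (*-monoˡ-≤ (square-nonneg (A i j)) (square≤dot x j)))))

  bil-nonneg-bounded : ∀ (A : Matrix n) → ∃ λ C → 0# ≤ C × ∀ x → bil A x x ≤ C * dot x x
  bil-nonneg-bounded A = let
      C , h = bil-bounded A
      0≤C′ = +-nonneg (+-nonneg (square-nonneg C) 0≤1) 0≤1
    in C * C + 1# + 1# , 0≤C′ , λ x → ≤-trans (h x)
      (≤-resp (*-comm _ _) (*-comm _ _) (*-monoˡ-≤ (dot-nonneg x) (x+x≤y⇒x≤y 0≤C′ (x+x≤x²+2 C))))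

  -- Semidefinite forms: uniform positivity or a null vector

  Coercive : Matrix n → Set (c ⊔ ℓ₁ ⊔ ℓ₂)
  Coercive A = ∃ λ ε → 0# < ε × ∀ x → ε * dot x x ≤ bil A x x

  NullVector : Matrix n → Set (c ⊔ ℓ₁)
  NullVector {n} A = ∃ λ (v : Vector Carrier n) → Nonzero v × bil A v v ≈ 0#

  -- y² is bounded by the completed square and l², and l² is absorbed into s.
  coercivity-bound : ∀ {α ε K η δ y l d q s} (let M = 1# + (1# + (K + K + α * α) * η)) →
    0# < α → 0# ≤ ε → 0# ≤ K → 0# ≤ η → ε * η ≈ 1# → 0# < M → M * δ ≈ 1# →
    0# ≤ d → l * l ≤ K * d → ε * d ≤ s → α * q ≈ (α * y + l) * (α * y + l) + s →
    α * δ * (y * y + d) ≤ q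
  coercivity-bound {α} {ε} {K} {η} {δ} {y} {l} {d} {q} {s}
      0<α 0≤ε 0≤K 0≤η εη≈1 0<M Mδ≈1 0≤d l²≤ εd≤s square =
    *-cancelˡ-≤ 0<M (*-cancelˡ-≤ 0<α (≤-resp lhs rhs main))
    where
    T M m : Carrier
    T = K + K + α * α
    M = 1# + (1# + T * η)
    m = α * y + l
    0≤T : 0# ≤ T
    0≤T = +-nonneg (+-nonneg 0≤K 0≤K) (square-nonneg α)
    0≤εd : 0# ≤ ε * d
    0≤εd = *-nonneg 0≤ε 0≤d
    lhs : α * α * (y * y + d) ≈ α * (M * (α * δ * (y * y + d)))
    lhs = sym (trans (solve 4 (λ a M d x → a :* (M :* (a :* d :* x)) := (M :* d) :* (a :* a :* x)) refl α M δ (y * y + d))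
          (trans (*-congʳ Mδ≈1) (*-identityˡ _)))
    rhs : M * (m * m + s) ≈ α * (M * q)
    rhs = trans (*-congˡ (sym square))
      (solve 3 (λ a M q → M :* (a :* q) := a :* (M :* q)) refl α M q)
    -- Since α y = m - l, the square (α y)² is at most 2 m² + 2 l², and l² ≤ K d. The slack is (α y
    -- + 2 l)² + 2 (K d - l²).
    step₁ : α * α * (y * y + d) ≤ (m * m + m * m) + T * d
    step₁ = ≤-cert
      (solve 5 (λ a y l k d →
           (((a :* y :+ l) :* (a :* y :+ l) :+ (a :* y :+ l) :* (a :* y :+ l)) :+ (k :+ k :+ a :* a) :* d)
             :- a :* a :* (y :* y :+ d)
           := (a :* y :+ l :+ l) :* (a :* y :+ l :+ l) :+ ((k :* d :- l :* l) :+ (k :* d :- l :* l)))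
         refl α y l K d)
      (+-nonneg (square-nonneg _) (+-nonneg (x≤y⇒0≤y-x l²≤) (x≤y⇒0≤y-x l²≤)))
    -- This dictates `M` = 2 + T η: the 2 covers 2 m², and T η times ε d is T d, because ε η = 1.
    step₂ : (m * m + m * m) + T * (ε * η * d) ≤ M * (m * m + ε * d)
    step₂ = ≤-cert
      (solve 5 (λ m t h e d →
           (con (+ 1) :+ (con (+ 1) :+ t :* h)) :* (m :* m :+ e :* d)
             :- ((m :* m :+ m :* m) :+ t :* (e :* h :* d))
           := t :* h :* (m :* m) :+ (e :* d :+ e :* d))
         refl m T η ε d)
      (+-nonneg (*-nonneg (*-nonneg 0≤T 0≤η) (square-nonneg m)) (+-nonneg 0≤εd 0≤εd))
    main : α * α * (y * y + d) ≤ M * (m * m + s)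
    main = ≤-trans step₁ (≤-trans
      (≤-resp (+-congˡ (*-congˡ (trans (*-congʳ εη≈1) (*-identityˡ d)))) refl step₂)
      (*-monoˡ-≤ (proj₁ 0<M) (+-mono-≤ ≤-refl εd≤s)))

  module SchurComplement (A : Matrix (suc n)) (symA : Symmetric A) where

    α : Carrier
    α = A zero zero

    b : Vector Carrier n
    b j = A zero (suc j)

    -- `S` = α C - b bᵀ is α times the Schur complement of the pivot α; the scaling avoids a
    -- division.
    C S : Matrix n
    C i j = A (suc i) (suc j)
    S i = combination α (C i) (- b i) b

    S-sym : Symmetric S
    S-sym i j = +-cong (*-congˡ (symA (suc i) (suc j)))
      (solve 2 (λ x y → (:- x) :* y := (:- y) :* x) refl (b i) (b j))

    block : ∀ x₀ x → bil A (cons x₀ x) (cons x₀ x) ≈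
            x₀ * (α * x₀ + dot b x) + (x₀ * dot b x + bil C x x)
    block x₀ x = +-congˡ (begin
      sum (λ i → x i * (A (suc i) zero * x₀ + dot (C i) x))
        ≈⟨ sum-cong (λ i → trans (*-congˡ (+-congʳ (*-congʳ (symA (suc i) zero))))
             (solve 4 (λ x b y c → x :* (b :* y :+ c) := y :* (b :* x) :+ x :* c)
                refl (x i) (b i) x₀ (dot (C i) x))) ⟩
      sum (λ i → x₀ * (b i * x i) + x i * dot (C i) x)
        ≈⟨ ∑-distrib-+ (λ i → x₀ * (b i * x i)) (λ i → x i * dot (C i) x) ⟩
      sum (λ i → x₀ * (b i * x i)) + bil C x x
        ≈⟨ +-congʳ (*-distribˡ-sum x₀ (λ i → b i * x i)) ⟨
      x₀ * dot b x + bil C x x ∎)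
      where open SetoidReasoning setoid

    bil-S : ∀ x → bil S x x ≈ α * bil C x x - dot b x * dot b x
    bil-S x = begin
      sum (λ i → x i * dot (S i) x)
        ≈⟨ sum-cong (λ i → *-congˡ (dot-combinationˡ α (C i) (- b i) b x)) ⟩
      sum (λ i → x i * (α * dot (C i) x + - b i * dot b x))
        ≈⟨ sum-cong (λ i → solve 5 (λ x a c b l → x :* (a :* c :+ (:- b) :* l) := a :* (x :* c) :+ (:- l) :* (b :* x))
             refl (x i) α (dot (C i) x) (b i) (dot b x)) ⟩
      sum (λ i → α * (x i * dot (C i) x) + - dot b x * (b i * x i))
        ≈⟨ ∑-distrib-+ (λ i → α * (x i * dot (C i) x)) (λ i → - dot b x * (b i * x i)) ⟩
      sum (λ i → α * (x i * dot (C i) x)) + sum (λ i → - dot b x * (b i * x i))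
        ≈⟨ +-cong (*-distribˡ-sum α (λ i → x i * dot (C i) x)) (*-distribˡ-sum (- dot b x) (λ i → b i * x i)) ⟨
      α * bil C x x + - dot b x * dot b x
        ≈⟨ solve 2 (λ u l → u :+ (:- l) :* l := u :- l :* l) refl (α * bil C x x) (dot b x) ⟩
      α * bil C x x - dot b x * dot b x ∎
      where open SetoidReasoning setoid

    complete-square : ∀ x₀ x → α * bil A (cons x₀ x) (cons x₀ x) ≈
      (α * x₀ + dot b x) * (α * x₀ + dot b x) + bil S x x
    complete-square x₀ x = trans (*-congˡ (block x₀ x)) (trans
      (solve 4 (λ a y l q → a :* (y :* (a :* y :+ l) :+ (y :* l :+ q))
                 := (a :* y :+ l) :* (a :* y :+ l) :+ (a :* q :- l :* l))
         refl α x₀ (dot b x) (bil C x x))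
      (+-congˡ (sym (bil-S x))))

    -- The first coordinate is chosen to make the completed square α x₀ + b·x vanish, leaving only
    -- the contribution of `S`. The factor α again avoids a division.
    lift : Vector Carrier n → Vector Carrier (suc n)
    lift y = cons (- dot b y) (λ i → α * y i)

    bil-lift : ∀ y → α * bil A (lift y) (lift y) ≈ α * α * bil S y y
    bil-lift y = begin
      α * bil A (lift y) (lift y)
        ≈⟨ complete-square (- dot b y) αy ⟩
      (α * - dot b y + dot b αy) * (α * - dot b y + dot b αy) + bil S αy αy
        ≈⟨ +-cong (*-cong l≈0 l≈0) (trans (dot-cong (λ _ → refl) λ i → dot-scaleʳ (S i) α y)
             (trans (dot-scaleʳ αy α (S ▷ y)) (*-congˡ (dot-scaleˡ α y (S ▷ y))))) ⟩
      0# * 0# + α * (α * bil S y y)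
        ≈⟨ solve 2 (λ a q → con (+ 0) :* con (+ 0) :+ a :* (a :* q) := a :* a :* q) refl α (bil S y y) ⟩
      α * α * bil S y y ∎
      where
      open SetoidReasoning setoid
      αy = λ i → α * y i
      l≈0 : α * - dot b y + dot b αy ≈ 0#
      l≈0 = trans (+-congˡ (dot-scaleʳ b α y))
        (solve 2 (λ a l → a :* (:- l) :+ a :* l := con (+ 0)) refl α (dot b y))

    e₀ : Vector Carrier (suc n)
    e₀ = cons 1# (λ _ → 0#)

    bil-e₀ : bil A e₀ e₀ ≈ α
    bil-e₀ = trans (block 1# (λ _ → 0#)) (trans
      (+-cong (*-congˡ (+-congˡ (dot-zeroʳ b))) (+-cong (*-congˡ (dot-zeroʳ b)) (dot-zeroˡ (C ▷ (λ _ → 0#)))))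
      (solve 1 (λ a → con (+ 1) :* (a :* con (+ 1) :+ con (+ 0)) :+ (con (+ 1) :* con (+ 0) :+ con (+ 0)) := a) refl α))

    module _ (0<α : 0# < α) where

      S-positive : PositiveSemidefinite A → PositiveSemidefinite S
      S-positive psd y = *-cancelˡ-≤ (*-pos 0<α 0<α)
        (≤-resp (sym (zeroʳ _)) (bil-lift y) (*-nonneg (proj₁ 0<α) (psd (lift y))))

      S-null : NullVector S → NullVector A
      S-null (v , (i , nz) , e) = lift v
        , (suc i , λ p → nz (x*y≈0⇒y≈0 (0<x⇒x≉0 0<α) p))
        , x*y≈0⇒y≈0 (0<x⇒x≉0 0<α) (trans (bil-lift v) (trans (*-congˡ e) (zeroʳ _)))

      S-coercive : Coercive S → Coercive A
      S-coercive (ε , 0<ε , h) = let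
          -- The form of the rank-one matrix b bᵀ is (b·x)², so `K` bounds the square of the linear
          -- term.
          K , 0≤K , l²≤ = bil-nonneg-bounded (λ i j → b i * b j)
          η , 0<η , εη≈1 = inverse 0<ε
          0<M = 0<x+y 0<1 (+-nonneg 0≤1 (*-nonneg (+-nonneg (+-nonneg 0≤K 0≤K) (square-nonneg α)) (proj₁ 0<η)))
          δ , 0<δ , Mδ≈1 = inverse 0<M
        in α * δ , *-pos 0<α 0<δ , λ x →
          coercivity-bound 0<α (proj₁ 0<ε) 0≤K (proj₁ 0<η) εη≈1 0<M Mδ≈1
            (dot-nonneg (x ∘ suc)) (≤-resp (rank-one (x ∘ suc)) refl (l²≤ (x ∘ suc)))
            (h (x ∘ suc)) (complete-square (x zero) (x ∘ suc))
        where
        rank-one : ∀ x → bil (λ i j → b i * b j) x x ≈ dot b x * dot b x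
        rank-one x = trans (dot-cong (λ _ → refl) (λ i → trans (dot-scaleˡ (b i) b x) (*-comm _ _)))
          (trans (dot-scaleʳ x (dot b x) b) (*-congˡ (dot-comm x b)))

  -- Elimination of the first coordinate. Semidefiniteness makes the pivot nonnegative: if it is
  -- zero, the first basis vector is null; if it is positive, either alternative is inherited from
  -- the Schur complement.
  coercive⊎null : ∀ {n} {A : Matrix n} → Symmetric A → PositiveSemidefinite A →
                  Coercive A ⊎ NullVector A
  coercive⊎null {zero} symA psd = inj₁ (1# , 0<1 , λ x → ≤-reflexive (zeroʳ 1#))
  coercive⊎null {suc n} {A} symA psd = [ pivot-zero , pivot-pos ]′ (0≤⇒≈0⊎0< (0≤-resp bil-e₀ (psd e₀)))
    where
    open SchurComplement A symA
    pivot-zero : α ≈ 0# → Coercive A ⊎ NullVector A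
    pivot-zero α≈0 = inj₂ (e₀ , (zero , λ e → 0≉1 (sym e)) , trans bil-e₀ α≈0)
    pivot-pos : 0# < α → Coercive A ⊎ NullVector A
    pivot-pos 0<α = Sum.map (S-coercive 0<α) (S-null 0<α) (coercive⊎null S-sym (S-positive 0<α psd))

  -- Moving from v in the direction -A v would make the form negative. With w = A v, m = w·w and k =
  -- w·A w, the vector (k + 1) v - m w has the value -(k + 2) m², which semidefiniteness forces to
  -- be zero.
  null⇒kernel : ∀ {A : Matrix n} → Symmetric A → PositiveSemidefinite A →
                ∀ v → bil A v v ≈ 0# → ∀ i → (A ▷ v) i ≈ 0#
  null⇒kernel {A = A} symA psd v null = dot-definite (x*x≈0⇒x≈0 m²≈0)
    where
    w = A ▷ v
    m = dot w w
    k = bil A w w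
    value : bil A (combination (k + 1#) v (- m) w) (combination (k + 1#) v (- m) w)
            ≈ - ((k + 1# + 1#) * (m * m))
    value = trans (bil-combination symA (k + 1#) v (- m) w)
      (trans (+-congʳ (+-cong (*-congˡ null) (+-cong (*-congˡ (bil-sym symA v w)) (*-congˡ (bil-sym symA v w)))))
      (solve 2 (λ k m → (k :+ con (+ 1)) :* (k :+ con (+ 1)) :* con (+ 0)
                  :+ ((k :+ con (+ 1)) :* (:- m) :* m :+ (k :+ con (+ 1)) :* (:- m) :* m) :+ (:- m) :* (:- m) :* k
                := :- ((k :+ con (+ 1) :+ con (+ 1)) :* (m :* m))) refl k m))
    0<k+2 : 0# < k + 1# + 1#
    0<k+2 = <-resp refl (solve 1 (λ k → con (+ 1) :+ (k :+ con (+ 1)) := k :+ con (+ 1) :+ con (+ 1)) refl k)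
      (0<x+y 0<1 (+-nonneg (psd w) 0≤1))
    m²≈0 : m * m ≈ 0#
    m²≈0 = antisym
      (*-cancelˡ-≤ 0<k+2 (≤-resp refl (sym (zeroʳ _))
        (≤-cert (trans (+-identityˡ _) (sym value)) (psd (combination (k + 1#) v (- m) w)))))
      (square-nonneg m)

  -- Existence of a positive eigenvalue

  identity : Matrix n
  identity zero    zero    = 1#
  identity zero    (suc _) = 0#
  identity (suc _) zero    = 0#
  identity (suc i) (suc j) = identity i j

  identity-sym : Symmetric (identity {n})
  identity-sym zero    zero    = refl
  identity-sym zero    (suc _) = refl
  identity-sym (suc _) zero    = refl
  identity-sym (suc i) (suc j) = identity-sym i j

  dot-identity : ∀ i (x : Vector Carrier n) → dot (identity i) x ≈ x i
  dot-identity zero    x = trans (+-cong (*-identityˡ _) (dot-zeroˡ (x ∘ suc))) (+-identityʳ _)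
  dot-identity (suc i) x = trans (+-cong (zeroˡ _) (dot-identity i (x ∘ suc))) (+-identityˡ _)

  shift : Carrier → Matrix n → Matrix n
  shift μ A i = combination μ (identity i) (- 1#) (A i)

  shift-▷ : ∀ μ (A : Matrix n) x i → (shift μ A ▷ x) i ≈ μ * x i + - 1# * (A ▷ x) i
  shift-▷ μ A x i = trans (dot-combinationˡ μ (identity i) (- 1#) (A i) x)
    (+-congʳ (*-congˡ (dot-identity i x)))

  shift-bil : ∀ μ (A : Matrix n) x → bil (shift μ A) x x ≈ μ * dot x x + - 1# * bil A x x
  shift-bil μ A x = trans (dot-cong (λ _ → refl) (shift-▷ μ A x))
    (dot-combinationʳ x μ x (- 1#) (A ▷ x))

  -- μ is the supremum of the Rayleigh quotients of A.  Were μI - A coercive,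
  -- a smaller bound would do; so it has a null vector, which is an eigenvector.
  module Rayleigh (A : Matrix n) (symA : Symmetric A) z (0<zAz : 0# < bil A z z) where

    -- All numbers below some Rayleigh quotient: the downward closure has the same supremum as the
    -- quotients and is described without division.
    Quotient : Carrier → Set (c ⊔ ℓ₁ ⊔ ℓ₂)
    Quotient r = ∃ λ x → 0# < dot x x × r * dot x x ≤ bil A x x

    C : Carrier
    C = proj₁ (bil-bounded A)

    bil≤C : ∀ x → bil A x x ≤ C * dot x x
    bil≤C = proj₂ (bil-bounded A)

    quotient : ∀ x → 0# < dot x x → ∃ λ r → Quotient r × r * dot x x ≈ bil A x x
    quotient x 0<xx = let
        s , _ , e = inverse 0<xx
        rxx = trans (solve 3 (λ a s d → a :* s :* d := (d :* s) :* a) refl (bil A x x) s (dot x x))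
                    (trans (*-congʳ e) (*-identityˡ _))
      in bil A x x * s , (x , 0<xx , ≤-reflexive rxx) , rxx

    0<zz : 0# < dot z z
    0<zz = ≤∧≉0⇒0< (dot-nonneg z) λ e → <⇒≱ 0<zAz
      (≤-resp refl (trans (*-congˡ e) (zeroʳ C)) (bil≤C z))

    bound⇒upper : ∀ K → (∀ x → bil A x x ≤ K * dot x x) → UpperBound Quotient K
    bound⇒upper K h r (x , 0<xx , le) = *-cancelˡ-≤ 0<xx
      (≤-resp (*-comm _ _) (*-comm _ _) (≤-trans le (h x)))

    supremum : ∃ (LeastUpperBound Quotient)
    supremum = let r , q , _ = quotient z 0<zz in
      complete Quotient (r , q) (C , bound⇒upper C bil≤C)

    μ : Carrier
    μ = proj₁ supremum

    bil≤μ : ∀ x → bil A x x ≤ μ * dot x x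
    bil≤μ x = [ zero-case , pos-case ]′ (0≤⇒≈0⊎0< (dot-nonneg x))
      where
      zero-case : dot x x ≈ 0# → bil A x x ≤ μ * dot x x
      zero-case e = ≤-resp refl (trans (*-congˡ e) (trans (zeroʳ C) (sym (trans (*-congˡ e) (zeroʳ μ))))) (bil≤C x)
      pos-case : 0# < dot x x → bil A x x ≤ μ * dot x x
      pos-case 0<xx = let r , q , e = quotient x 0<xx in
        ≤-resp (trans (*-comm _ _) e) (*-comm _ _) (*-monoˡ-≤ (proj₁ 0<xx) (proj₁ (proj₂ supremum) r q))

    0<μ : 0# < μ
    0<μ = ≤∧≉0⇒0< (*-cancelˡ-≤ 0<zz (≤-resp (sym (zeroʳ _)) (*-comm _ _) (≤-trans (proj₁ 0<zAz) (bil≤μ z))))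
      λ e → <⇒≱ 0<zAz (≤-resp refl (trans (*-congʳ e) (zeroˡ _)) (bil≤μ z))

    B : Matrix n
    B = shift μ A

    B-sym : Symmetric B
    B-sym i j = +-cong (*-congˡ (identity-sym i j)) (*-congˡ (symA i j))

    B-psd : PositiveSemidefinite B
    B-psd x = 0≤-resp
      (trans (solve 2 (λ u q → u :- q := u :+ (:- con (+ 1)) :* q) refl (μ * dot x x) (bil A x x)) (sym (shift-bil μ A x)))
      (x≤y⇒0≤y-x (bil≤μ x))

    not-coercive : ¬ Coercive B
    not-coercive (ε , 0<ε , h) = <⇒≱ 0<ε (≤-cert
      (solve 2 (λ μ ε → con (+ 0) :- ε := (μ :- ε) :- μ) refl μ ε)
      (x≤y⇒0≤y-x (proj₂ (proj₂ supremum) (μ - ε) (bound⇒upper (μ - ε) bound))))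
      where
      bound : ∀ x → bil A x x ≤ (μ - ε) * dot x x
      bound x = ≤-cert
        (trans (solve 4 (λ μ ε d q → (μ :- ε) :* d :- q := (μ :* d :+ (:- con (+ 1)) :* q) :- ε :* d) refl μ ε (dot x x) (bil A x x))
               (+-congʳ (sym (shift-bil μ A x))))
        (x≤y⇒0≤y-x (h x))

    null-eigen : NullVector B → ∃ λ v → Nonzero v × InEigenspace A μ v
    null-eigen (v , nz , null) = v , nz , λ i → trans
      (solve 2 (λ a u → a := u :- (u :+ (:- con (+ 1)) :* a)) refl ((A ▷ v) i) (μ * v i))
      (trans (+-congˡ (trans (-‿cong (trans (sym (shift-▷ μ A v i)) (null⇒kernel B-sym B-psd v null i))) -0#≈0#))
             (+-identityʳ _))

    eigenvalue : Eigenvalue A μ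
    eigenvalue = [ (λ co → ⊥-elim (not-coercive co)) , null-eigen ]′ (coercive⊎null B-sym B-psd)

  positive-eigenvalue : ∀ {A : Matrix n} → Symmetric A → ∀ z → 0# < bil A z z →
                        ∃ λ μ → 0# < μ × Eigenvalue A μ
  positive-eigenvalue {A = A} symA z h = μ , 0<μ , eigenvalue
    where open Rayleigh A symA z h

  -- Orthogonality to the positive eigenvector

  eigen-bil : ∀ {A : Matrix n} {μ v} → InEigenspace A μ v → ∀ x → bil A x v ≈ μ * dot x v
  eigen-bil {μ = μ} {v} h x = trans (dot-cong (λ _ → refl) h) (dot-scaleʳ x μ v)

  orthogonal-independent : ∀ {v w : Vector Carrier n} → Nonzero v → Nonzero w → dot v w ≈ 0# →
                           ¬ LinearlyDependent {2} (cons v (cons w λ ()))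
  orthogonal-independent {v = v} {w} nv nw v⊥w (α , (s , nz) , h) = nz (vanish s)
    where
    relation : ∀ i → combination (α zero) v (α (suc zero)) w i ≈ 0#
    relation i = trans (+-congˡ (sym (+-identityʳ _))) (h i)
    against : ∀ u → α zero * dot u v + α (suc zero) * dot u w ≈ 0#
    against u = trans (sym (dot-combinationʳ u (α zero) v (α (suc zero)) w))
      (trans (dot-cong (λ _ → refl) relation) (dot-zeroʳ u))
    vanish : ∀ s → α s ≈ 0#
    vanish zero = x*y≈0⇒y≈0 (0<x⇒x≉0 (dot-pos nv)) (trans (*-comm _ _)
      (trans (sym (trans (+-congˡ (trans (*-congˡ v⊥w) (zeroʳ _))) (+-identityʳ _))) (against v)))
    vanish (suc zero) = x*y≈0⇒y≈0 (0<x⇒x≉0 (dot-pos nw)) (trans (*-comm _ _)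
      (trans (sym (trans (+-congʳ (trans (*-congˡ (trans (dot-comm w v) v⊥w)) (zeroʳ _))) (+-identityˡ _))) (against w)))

  module Deflation (A : Matrix n) (symA : Symmetric A) λ₁ v (nv : Nonzero v) (Av : InEigenspace A λ₁ v) where

    -- `A′` = |v|² A - λ₁ v vᵀ is deflation scaled by |v|²: it annihilates v, and its form agrees
    -- with that of |v|² A on the orthogonal complement of v.
    A′ : Matrix n
    A′ i = combination (dot v v) (A i) (- (λ₁ * v i)) v

    A′-sym : Symmetric A′
    A′-sym i j = +-cong (*-congˡ (symA i j))
      (solve 3 (λ l x y → (:- (l :* x)) :* y := (:- (l :* y)) :* x) refl λ₁ (v i) (v j))

    A′-▷ : ∀ x i → (A′ ▷ x) i ≈ dot v v * (A ▷ x) i + - (λ₁ * dot v x) * v i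
    A′-▷ x i = trans (dot-combinationˡ (dot v v) (A i) (- (λ₁ * v i)) v x)
      (+-congˡ (solve 3 (λ l x y → (:- (l :* x)) :* y := (:- (l :* y)) :* x) refl λ₁ (v i) (dot v x)))

    bil-A′ : ∀ y x → bil A′ y x ≈ dot v v * bil A y x + - (λ₁ * dot v x) * dot y v
    bil-A′ y x = trans (dot-cong (λ _ → refl) (A′-▷ x))
      (dot-combinationʳ y (dot v v) (A ▷ x) (- (λ₁ * dot v x)) v)

    v-kernel : ∀ x → bil A′ v x ≈ 0#
    v-kernel x = trans (bil-A′ v x) (trans
      (+-congʳ (*-congˡ (trans (bil-sym symA v x) (trans (eigen-bil Av x) (*-congˡ (dot-comm x v))))))
      (solve 3 (λ d l p → d :* (l :* p) :+ (:- (l :* p)) :* d := con (+ 0)) refl (dot v v) λ₁ (dot v x)))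

    -- `A′` is still positive at z, so it has an eigenvector w with an eigenvalue μ′ > 0. Then μ′
    -- (v·w) = v·A′ w = 0 gives the orthogonality, and there A′ w = |v|² A w, so that the eigenvalue
    -- of A is μ′ / |v|².
    orthogonal-eigenvalue : ∀ z → dot v z ≈ 0# → 0# < bil A z z →
      ∃ λ μ → 0# < μ × ∃ λ w → Nonzero w × InEigenspace A μ w × dot v w ≈ 0#
    orthogonal-eigenvalue z v⊥z 0<zAz = let
        0<vv = dot-pos nv
        zA′z = trans (bil-A′ z z) (trans (+-congˡ (*-congˡ (trans (dot-comm z v) v⊥z)))
                 (trans (+-congˡ (zeroʳ _)) (+-identityʳ _)))
        μ′ , 0<μ′ , w , nw , A′w = positive-eigenvalue A′-sym z (<-resp refl (sym zA′z) (*-pos 0<vv 0<zAz))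
        v⊥w = x*y≈0⇒y≈0 (0<x⇒x≉0 0<μ′) (trans (sym (eigen-bil A′w v)) (v-kernel w))
        s , 0<s , e = inverse 0<vv
      in μ′ * s , *-pos 0<μ′ 0<s , w , nw
         , (λ i → begin
             (A ▷ w) i
               ≈⟨ *-identityˡ _ ⟨
             1# * (A ▷ w) i
               ≈⟨ *-congʳ e ⟨
             dot v v * s * (A ▷ w) i
               ≈⟨ solve 5 (λ d s a l y → d :* s :* a := s :* (d :* a :+ (:- (l :* con (+ 0))) :* y)) refl (dot v v) s ((A ▷ w) i) λ₁ (v i) ⟩
             s * (dot v v * (A ▷ w) i + - (λ₁ * 0#) * v i)
               ≈⟨ *-congˡ (+-congˡ (*-congʳ (-‿cong (*-congˡ v⊥w)))) ⟨
             s * (dot v v * (A ▷ w) i + - (λ₁ * dot v w) * v i)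
               ≈⟨ *-congˡ (A′-▷ w i) ⟨
             s * (A′ ▷ w) i
               ≈⟨ *-congˡ (A′w i) ⟩
             s * (μ′ * w i)
               ≈⟨ solve 3 (λ s μ w → s :* (μ :* w) := μ :* s :* w) refl s μ′ (w i) ⟩
             μ′ * s * w i ∎)
         , v⊥w
      where open SetoidReasoning setoid

  -- A positive value would yield a second positive eigenvector w orthogonal to v. Uniqueness puts w
  -- into the eigenspace of v, and simplicity would then make two nonzero orthogonal vectors
  -- dependent.
  no-orthogonal-positive : ∀ {A : Matrix n} → Symmetric A → AtMostOnePositiveEigenvalue A →
    ∀ {λ₁ v} → 0# < λ₁ → Nonzero v → InEigenspace A λ₁ v →
    ∀ z → dot v z ≈ 0# → bil A z z ≤ 0#
  no-orthogonal-positive {A = A} symA (unique , simple) {λ₁} {v} 0<λ₁ nv Av z v⊥z =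
    ≤-by-contradiction λ 0<zAz → let
      μ , 0<μ , w , nw , Aw , v⊥w = Deflation.orthogonal-eigenvalue A symA λ₁ v nv Av z v⊥z 0<zAz
      μ≈λ₁ = unique 0<μ (w , nw , Aw) 0<λ₁ (v , nv , Av)
    in orthogonal-independent nv nw v⊥w
         (simple 0<λ₁ (v , nv , Av) (cons v (cons w λ ()))
           λ { zero → Av ; (suc zero) i → trans (Aw i) (*-congʳ μ≈λ₁) })

  -- The hypothesis says that the binary quadratic form with coefficients a, b, d has a value Q ≤ 0
  -- at (p, -q). The inequality follows from p² (b² - a d) = (p b - q d)² - d Q.
  discriminant : ∀ {p q a b d} → ¬ (p ≈ 0#) → 0# ≤ d →
    p * p * a + (p * - q * b + p * - q * b) + - q * - q * d ≤ 0# → a * d ≤ b * b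
  discriminant {p} {q} {a} {b} {d} p≉0 0≤d h = *-cancelˡ-≤ (square-pos p≉0) (≤-cert
    (solve 5 (λ p q a b d → p :* p :* (b :* b) :- p :* p :* (a :* d)
        := (p :* b :- q :* d) :* (p :* b :- q :* d)
           :+ d :* (con (+ 0) :- (p :* p :* a :+ (p :* (:- q) :* b :+ p :* (:- q) :* b) :+ (:- q) :* (:- q) :* d)))
      refl p q a b d)
    (+-nonneg (square-nonneg _) (*-nonneg 0≤d (x≤y⇒0≤y-x h))))

  -- The plane spanned by x and y meets the orthogonal complement of the
  -- positive eigenvector.
  reverse-cauchy-schwarz : ∀ {A : Matrix n} → Symmetric A → AtMostOnePositiveEigenvalue A →
    ∀ x y → 0# ≤ bil A y y → bil A x x * bil A y y ≤ bil A x y * bil A x y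
  reverse-cauchy-schwarz {A = A} symA amo x y 0≤yy = [ zero-case , pos-case ]′ (0≤⇒≈0⊎0< 0≤yy)
    where
    a = bil A x x
    b = bil A x y
    d = bil A y y
    zero-case : d ≈ 0# → a * d ≤ b * b
    zero-case e = ≤-resp (sym (trans (*-congˡ e) (zeroʳ a))) refl (square-nonneg b)
    pos-case : 0# < d → a * d ≤ b * b
    pos-case 0<d = let
        λ₁ , 0<λ₁ , v , nv , Av = positive-eigenvalue symA y 0<d
        p = dot v y
        q = dot v x
        h = no-orthogonal-positive symA amo 0<λ₁ nv Av
        -- If y were orthogonal to v, the form could not be positive at y.
        p≉0 : ¬ (p ≈ 0#)
        p≉0 e = <⇒≱ 0<d (h y e)
        z = combination p x (- q) y
        v⊥z = trans (dot-combinationʳ v p x (- q) y) (solve 2 (λ p q → p :* q :+ (:- q) :* p := con (+ 0)) refl p q)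
        zz≤0 = ≤-resp (bil-combination symA p x (- q) y) refl (h z v⊥z)
      in discriminant p≉0 0≤yy zz≤0

-- Forms with the Alexandrov-Fenchel inequality

module Hyperbolicity {c ℓ₁ ℓ₂} (ℝ : CompleteOrderedField c ℓ₁ ℓ₂) (n : ℕ) where

  open OrderedField ℝ
  open WeightedGraphs ℝ
  open FiniteSums ℝ
  open SpectralTheory ℝ

  𝕍 : Set c
  𝕍 = Vector Carrier n

  Nonneg : 𝕍 → Set ℓ₂
  Nonneg x = ∀ i → 0# ≤ x i

  NonnegNonzero : 𝕍 → Set (ℓ₁ ⊔ ℓ₂)
  NonnegNonzero x = Nonneg x × ∃ λ i → 0# < x i

  Form : Set c
  Form = 𝕍 → 𝕍 → Carrier

  -- The sign of x is left free because the inequality is later applied to vectors x in the kernel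
  -- of a linear functional.
  Hyperbolic : Form → Set (c ⊔ ℓ₂)
  Hyperbolic B = ∀ x y → Nonneg y → B x x * B y y ≤ B x y * B x y

  zero⊎nonzero : ∀ {m} {x : Vector Carrier m} → (∀ i → 0# ≤ x i) →
                 (∀ i → x i ≈ 0#) ⊎ (∃ λ i → 0# < x i)
  zero⊎nonzero {zero}  h = inj₁ λ ()
  zero⊎nonzero {suc m} h with 0≤⇒≈0⊎0< (h zero) | zero⊎nonzero (h ∘ suc)
  ... | inj₂ p | _            = inj₂ (zero , p)
  ... | inj₁ _ | inj₂ (i , p) = inj₂ (suc i , p)
  ... | inj₁ e | inj₁ f       = inj₁ λ { zero → e ; (suc i) → f i }

  Hyperbolic-resp : ∀ {B B′ : Form} → (∀ x y → B x y ≈ B′ x y) → Hyperbolic B → Hyperbolic B′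
  Hyperbolic-resp e h x y 0≤y = ≤-resp (*-cong (e x x) (e y y)) (*-cong (e x y) (e x y)) (h x y 0≤y)

  Hyperbolic-zero : ∀ {B : Form} → (∀ x y → B x y ≈ 0#) → Hyperbolic B
  Hyperbolic-zero e x y _ = ≤-reflexive (trans (*-cong (e x x) (e y y)) (sym (*-cong (e x y) (e x y))))

  Hyperbolic-scale : ∀ s {B : Form} → Hyperbolic B → Hyperbolic (λ x y → s * B x y)
  Hyperbolic-scale s {B} h x y 0≤y = ≤-resp (regroup (B x x) (B y y)) (regroup (B x y) (B x y))
    (*-monoˡ-≤ (square-nonneg s) (h x y 0≤y))
    where
    regroup : ∀ u v → s * s * (u * v) ≈ s * u * (s * v)
    regroup u v = solve 3 (λ s u v → s :* s :* (u :* v) := s :* u :* (s :* v)) refl s u v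

  -- Abstracts a volume with all but three arguments fixed. The two adjacent swaps generate every
  -- permutation of the three; `T-pos` is the nondegeneracy secured by positive weights.
  record SymmetricTrilinear : Set (c ⊔ ℓ₁ ⊔ ℓ₂) where
    field
      T        : 𝕍 → 𝕍 → 𝕍 → Carrier
      T-cong   : ∀ {x x′} y z → (∀ i → x i ≈ x′ i) → T x y z ≈ T x′ y z
      T-linear : ∀ s x t y p q → T (combination s x t y) p q ≈ s * T x p q + t * T y p q
      T-swap₁₂ : ∀ x y z → T x y z ≈ T y x z
      T-swap₂₃ : ∀ x y z → T x y z ≈ T x z y
      T-pos    : ∀ {x y z} → NonnegNonzero x → NonnegNonzero y → NonnegNonzero z → 0# < T x y z

    T-zero : ∀ {x} y z → (∀ i → x i ≈ 0#) → T x y z ≈ 0#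
    T-zero {x} y z e = trans
      (T-cong y z λ i → trans (e i) (sym (trans (+-cong (zeroˡ _) (zeroˡ _)) (+-identityˡ 0#))))
      (trans (T-linear 0# x 0# x y z) (trans (+-cong (zeroˡ _) (zeroˡ _)) (+-identityˡ 0#)))

    T-nonneg : ∀ {x y z} → Nonneg x → Nonneg y → Nonneg z → 0# ≤ T x y z
    T-nonneg {x} {y} {z} px py pz with zero⊎nonzero px | zero⊎nonzero py | zero⊎nonzero pz
    ... | inj₂ nx | inj₂ ny | inj₂ nz = proj₁ (T-pos (px , nx) (py , ny) (pz , nz))
    ... | inj₁ e  | _       | _       = ≤-reflexive (sym (T-zero y z e))
    ... | inj₂ _  | inj₁ e  | _       = ≤-reflexive (sym (trans (T-swap₁₂ x y z) (T-zero x z e)))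
    ... | inj₂ _  | inj₂ _  | inj₁ e  = ≤-reflexive (sym (trans (T-swap₂₃ x y z) (trans (T-swap₁₂ x z y) (T-zero x y e))))

    T-linear₃ : ∀ p q s x t y → T p q (combination s x t y) ≈ s * T p q x + t * T p q y
    T-linear₃ p q s x t y = trans (rotate (combination s x t y)) (trans (T-linear s x t y p q)
        (sym (+-cong (*-congˡ (rotate x)) (*-congˡ (rotate y)))))
      where
      rotate : ∀ z → T p q z ≈ T z p q
      rotate z = trans (T-swap₂₃ p q z) (T-swap₁₂ p z q)

    T-square : ∀ p s x t y → T p (combination s x t y) (combination s x t y) ≈
      s * s * T p x x + (s * t * T p x y + s * t * T p x y) + t * t * T p y y
    T-square p s x t y = begin
      T p w w
        ≈⟨ T-linear₃ p w s x t y ⟩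
      s * T p w x + t * T p w y
        ≈⟨ +-cong (*-congˡ (trans (T-swap₂₃ p w x) (T-linear₃ p x s x t y)))
                  (*-congˡ (trans (T-swap₂₃ p w y) (T-linear₃ p y s x t y))) ⟩
      s * (s * T p x x + t * T p x y) + t * (s * T p y x + t * T p y y)
        ≈⟨ +-congˡ (*-congˡ (+-congʳ (*-congˡ (T-swap₂₃ p y x)))) ⟩
      s * (s * T p x x + t * T p x y) + t * (s * T p x y + t * T p y y)
        ≈⟨ solve 5 (λ s t a b c → s :* (s :* a :+ t :* b) :+ t :* (s :* b :+ t :* c)
                      := s :* s :* a :+ (s :* t :* b :+ s :* t :* b) :+ t :* t :* c)
                   refl s t (T p x x) (T p x y) (T p y y) ⟩
      s * s * T p x x + (s * t * T p x y + s * t * T p x y) + t * t * T p y y ∎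
      where
      open SetoidReasoning setoid
      w = combination s x t y

    -- Test the inequality against q: T p z z · T p q q ≤ (T p z q)² = 0, where T p q q > 0.
    nonpositive-on-kernel : ∀ {p q} → NonnegNonzero p → NonnegNonzero q → Hyperbolic (T p) →
                            ∀ z → T p q z ≈ 0# → T p z z ≤ 0#
    nonpositive-on-kernel {p} {q} p>0 q>0 h z e = *-cancelˡ-≤ (T-pos p>0 q>0 q>0)
      (≤-resp (*-comm _ _) (trans (*-cong e′ e′) (trans (zeroˡ 0#) (sym (zeroʳ _)))) (h z q (proj₁ q>0)))
      where
      e′ : T p z q ≈ 0#
      e′ = trans (T-swap₂₃ p z q) e

    -- T p and T q are nonpositive on the kernel of the common functional
    -- T p q = T q p, hence so is their sum.
    Hyperbolic-sum : ∀ {p q} → NonnegNonzero p → NonnegNonzero q → Hyperbolic (T p) → Hyperbolic (T q) →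
                     Hyperbolic (T (combination 1# p 1# q))
    Hyperbolic-sum {p} {q} p>0 q>0 hp hq x y 0≤y = [ zero-case , pos-case ]′ (zero⊎nonzero 0≤y)
      where
      r = combination 1# p 1# q
      split : ∀ u v → T r u v ≈ 1# * T p u v + 1# * T q u v
      split = T-linear 1# p 1# q
      0≤r : Nonneg r
      0≤r i = +-nonneg (*-nonneg 0≤1 (proj₁ p>0 i)) (*-nonneg 0≤1 (proj₁ q>0 i))
      zero-case : (∀ i → y i ≈ 0#) → T r x x * T r y y ≤ T r x y * T r x y
      zero-case e = ≤-resp
        (sym (trans (*-congˡ (trans (T-swap₁₂ r y y) (T-zero r y e))) (zeroʳ _))) refl (square-nonneg _)
      pos-case : ∃ (λ i → 0# < y i) → T r x x * T r y y ≤ T r x y * T r x y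
      pos-case ny = discriminant (0<x⇒x≉0 (T-pos p>0 q>0 (0≤y , ny))) (T-nonneg 0≤r 0≤y 0≤y)
        (≤-resp (T-square r (T p q y) x (- T p q x) y) refl rzz≤0)
        where
        -- The combination of x and y killed by the functional T p q. Its coefficient at x is
        -- positive, so `discriminant` turns nonpositivity at z into the inequality for x and y.
        z = combination (T p q y) x (- T p q x) y
        ℓz : T p q z ≈ 0#
        ℓz = trans (T-linear₃ p q (T p q y) x (- T p q x) y)
          (solve 2 (λ u v → u :* v :+ (:- v) :* u := con (+ 0)) refl (T p q y) (T p q x))
        rzz≤0 : T r z z ≤ 0#
        rzz≤0 = ≤-resp (trans (sym (+-cong (*-identityˡ _) (*-identityˡ _))) (sym (split z z))) (+-identityˡ 0#)
          (+-mono-≤ (nonpositive-on-kernel p>0 q>0 hp z ℓz)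
                    (nonpositive-on-kernel q>0 p>0 hq z (trans (T-swap₁₂ q p z) ℓz)))

    Hyperbolic-cong : ∀ {p q} → (∀ i → p i ≈ q i) → Hyperbolic (T p) → Hyperbolic (T q)
    Hyperbolic-cong e = Hyperbolic-resp λ x y → T-cong x y e

    -- `Hyperbolic-sum` accepts only nonzero vectors, so in the induction a vanishing head or tail
    -- is discarded instead of added.
    Hyperbolic-Σ : ∀ {m} (f : Fin m → 𝕍) → (∀ k → Nonneg (f k)) → (∀ k → Hyperbolic (T (f k))) →
                   Hyperbolic (T (λ i → sum (λ k → f k i)))
    Hyperbolic-Σ {zero}  f nonneg h = Hyperbolic-zero λ x y → T-zero x y λ i → refl
    Hyperbolic-Σ {suc m} f nonneg h
      with zero⊎nonzero (nonneg zero)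
         | zero⊎nonzero {x = λ i → sum (λ k → f (suc k) i)} (λ i → sum-nonneg λ k → nonneg (suc k) i)
         | Hyperbolic-Σ (f ∘ suc) (nonneg ∘ suc) (h ∘ suc)
    ... | inj₁ e  | _       | ih = Hyperbolic-cong (λ i → sym (trans (+-congʳ (e i)) (+-identityˡ _))) ih
    ... | inj₂ _  | inj₁ e  | _  = Hyperbolic-cong (λ i → sym (trans (+-congˡ (e i)) (+-identityʳ _))) (h zero)
    ... | inj₂ n₀ | inj₂ n₁ | ih = Hyperbolic-cong (λ i → +-cong (*-identityˡ _) (*-identityˡ _))
      (Hyperbolic-sum (nonneg zero , n₀) ((λ i → sum-nonneg λ k → nonneg (suc k) i) , n₁) (h zero) ih)

    basis : Fin n → 𝕍
    basis k i = identity i k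

    T-scale : ∀ s x p q → T (λ i → s * x i) p q ≈ s * T x p q
    T-scale s x p q = trans (T-cong p q λ i → sym (trans (+-congˡ (zeroˡ _)) (+-identityʳ _)))
      (trans (T-linear s x 0# x p q) (trans (+-congˡ (zeroˡ _)) (+-identityʳ _)))

    identity-nonneg : ∀ {m} (i j : Fin m) → 0# ≤ identity i j
    identity-nonneg zero    zero    = 0≤1
    identity-nonneg zero    (suc j) = ≤-refl
    identity-nonneg (suc i) zero    = ≤-refl
    identity-nonneg (suc i) (suc j) = identity-nonneg i j

    Hyperbolic-nonneg : (∀ k → Hyperbolic (T (basis k))) → ∀ {p} → Nonneg p → Hyperbolic (T p)
    Hyperbolic-nonneg h {p} 0≤p = Hyperbolic-cong
      (λ i → trans (dot-comm p (identity i)) (dot-identity i p))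
      (Hyperbolic-Σ (λ k i → p k * basis k i) (λ k i → *-nonneg (0≤p k) (identity-nonneg i k))
        (λ k → Hyperbolic-resp (λ x y → sym (T-scale (p k) (basis k) x y)) (Hyperbolic-scale (p k) (h k))))

-- Clique volumes by recursion on the vertices

module Volumes {c ℓ₁ ℓ₂} (ℝ : CompleteOrderedField c ℓ₁ ℓ₂) (n : ℕ) where

  open OrderedField ℝ
  open WeightedGraphs ℝ
  open FiniteSums ℝ
  open SpectralTheory ℝ
  open Hyperbolicity ℝ n

  -- vol A g (x₁ ∷ … ∷ xₜ ∷ []) is the K_t-volume of (g x₁, …, g xₜ).  Once the
  -- first vertex is placed at v, the field g on the others becomes g · A v.
  vol : Matrix n → 𝕍 → List 𝕍 → Carrier
  vol A g []       = 1#
  vol A g (x ∷ ps) = sum (λ v → x v * (g v * vol A (λ u → g u * A v u) ps))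

  -- bivol A t a b is the volume of K_t × K_2; here the vectors themselves absorb
  -- the weights to the placed vertices.
  bivol : Matrix n → ℕ → 𝕍 → 𝕍 → Carrier
  bivol A zero    a b = 1#
  bivol A (suc t) a b = sum (λ u → sum (λ w →
    a u * b w * bivol A t (λ v → A w v * a v) (λ v → A u v * b v)))

  unit : 𝕍
  unit _ = 1#

  bivol-nonneg : ∀ {A} → (∀ i j → 0# ≤ A i j) → ∀ t {a b} → Nonneg a → Nonneg b → 0# ≤ bivol A t a b
  bivol-nonneg 0≤A zero    0≤a 0≤b = 0≤1
  bivol-nonneg 0≤A (suc t) 0≤a 0≤b = sum-nonneg λ u → sum-nonneg λ w →
    *-nonneg (*-nonneg (0≤a u) (0≤b w))
      (bivol-nonneg 0≤A t (λ v → *-nonneg (0≤A w v) (0≤a v)) (λ v → *-nonneg (0≤A u v) (0≤b v)))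

  vol-nonneg : ∀ {A} → (∀ i j → 0# ≤ A i j) → ∀ {g ps} → Nonneg g → All Nonneg ps → 0# ≤ vol A g ps
  vol-nonneg 0≤A 0≤g []         = 0≤1
  vol-nonneg 0≤A 0≤g (px ∷ pps) = sum-nonneg λ v → *-nonneg (px v) (*-nonneg (0≤g v)
    (vol-nonneg 0≤A (λ u → *-nonneg (0≤g u) (0≤A v u)) pps))

  vol-mono : ∀ {A A′} → (∀ i j → 0# ≤ A i j) → (∀ i j → A i j ≤ A′ i j) →
             ∀ {g g′ ps} → Nonneg g → (∀ i → g i ≤ g′ i) → All Nonneg ps → vol A g ps ≤ vol A′ g′ ps
  vol-mono 0≤A A≤A′ 0≤g g≤g′ []         = ≤-refl
  vol-mono 0≤A A≤A′ 0≤g g≤g′ (px ∷ pps) = sum-mono λ v → *-monoˡ-≤ (px v)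
    (*-mono-≤ (0≤g v) (vol-nonneg 0≤A (λ u → *-nonneg (0≤g u) (0≤A v u)) pps) (g≤g′ v)
      (vol-mono 0≤A A≤A′ (λ u → *-nonneg (0≤g u) (0≤A v u))
        (λ u → *-mono-≤ (0≤g u) (0≤A v u) (g≤g′ u) (A≤A′ v u)) pps))

  vol-vanish : ∀ {A g x} ps → (∀ i → x i ≈ 0#) → vol A g (x ∷ ps) ≈ 0#
  vol-vanish ps e = sum-zero λ v → trans (*-congʳ (e v)) (zeroˡ _)

  vol-edgeless : ∀ {A g} x y ps → (∀ i j → A i j ≈ 0#) → vol A g (x ∷ y ∷ ps) ≈ 0#
  vol-edgeless x y ps e = sum-zero λ v → trans (*-congˡ (trans (*-congˡ
    (sum-zero λ w → trans (*-congˡ (trans (*-congʳ (trans (*-congˡ (e v w)) (zeroʳ _))) (zeroˡ _))) (zeroʳ _)))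
    (zeroʳ _))) (zeroʳ _)

  module _ (A : Matrix n) where

    vol-cong : ∀ {g g′} ps → (∀ i → g i ≈ g′ i) → vol A g ps ≈ vol A g′ ps
    vol-cong []       e = refl
    vol-cong (x ∷ ps) e = sum-cong λ v → *-congˡ (*-cong (e v) (vol-cong ps λ u → *-congʳ (e u)))

    vol-head-cong : ∀ {g x x′} ps → (∀ i → x i ≈ x′ i) → vol A g (x ∷ ps) ≈ vol A g (x′ ∷ ps)
    vol-head-cong ps e = sum-cong λ v → *-congʳ (e v)

    vol-tail-cong : ∀ {g} x ps qs → (∀ g → vol A g ps ≈ vol A g qs) → vol A g (x ∷ ps) ≈ vol A g (x ∷ qs)
    vol-tail-cong {g} x ps qs e = sum-cong λ v → *-congˡ (*-congˡ (e (λ u → g u * A v u)))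

    vol-linear : ∀ {g} s x t y ps → vol A g (combination s x t y ∷ ps) ≈ s * vol A g (x ∷ ps) + t * vol A g (y ∷ ps)
    vol-linear {g} s x t y ps = dot-combinationˡ s x t y (λ v → g v * vol A (λ u → g u * A v u) ps)

    -- Every vertex contributes one factor from the field and one from its vector, so k can pass
    -- between them. This translates the convention of `vol` into that of `bivol`.
    vol-field : ∀ (g k : 𝕍) t (a : 𝕍) → vol A (λ u → g u * k u) (replicate t a) ≈ vol A g (replicate t (λ u → k u * a u))
    vol-field g k zero    a = refl
    vol-field g k (suc t) a = sum-cong λ v → trans
      (*-congˡ (*-congˡ (trans
        (vol-cong (replicate t a) λ u → solve 3 (λ g k w → g :* k :* w := g :* w :* k) refl (g u) (k u) (A v u))
        (vol-field (λ u → g u * A v u) k t a))))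
      (solve 4 (λ x g k z → x :* (g :* k :* z) := k :* x :* (g :* z)) refl (a v) (g v) (k v)
         (vol A (λ u → g u * A v u) (replicate t (λ u → k u * a u))))

    module _ (symA : Symmetric A) where

      vol-swap : ∀ g x y ps → vol A g (x ∷ y ∷ ps) ≈ vol A g (y ∷ x ∷ ps)
      vol-swap g x y ps = begin
        sum (λ v → x v * (g v * sum (λ w → y w * (g w * A v w * F v w))))
          ≈⟨ sum-cong (λ v → trans (sym (*-assoc _ _ _)) (*-distribˡ-sum (x v * g v) (λ w → y w * (g w * A v w * F v w)))) ⟩
        sum (λ v → sum (λ w → x v * g v * (y w * (g w * A v w * F v w))))
          ≈⟨ ∑-comm (λ v w → x v * g v * (y w * (g w * A v w * F v w))) ⟩
        sum (λ w → sum (λ v → x v * g v * (y w * (g w * A v w * F v w))))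
          ≈⟨ sum-cong (λ w → sum-cong λ v → exchange v w) ⟩
        sum (λ w → sum (λ v → y w * g w * (x v * (g v * A w v * F w v))))
          ≈⟨ sum-cong (λ w → trans (sym (*-assoc _ _ _)) (*-distribˡ-sum (y w * g w) (λ v → x v * (g v * A w v * F w v)))) ⟨
        sum (λ w → y w * (g w * sum (λ v → x v * (g v * A w v * F w v)))) ∎
        where
        open SetoidReasoning setoid
        F : Fin n → Fin n → Carrier
        F v w = vol A (λ u → g u * A v u * A w u) ps
        exchange : ∀ v w → x v * g v * (y w * (g w * A v w * F v w)) ≈ y w * g w * (x v * (g v * A w v * F w v))
        exchange v w = trans
          (*-congˡ (*-congˡ (*-cong (*-congˡ (symA v w)) (vol-cong ps λ u →
            solve 3 (λ g a b → g :* a :* b := g :* b :* a) refl (g u) (A v u) (A w u)))))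
          (solve 6 (λ x g y h a f → x :* g :* (y :* (h :* a :* f)) := y :* h :* (x :* (g :* a :* f)))
             refl (x v) (g v) (y w) (g w) (A w v) (F w v))

      vol-shift : ∀ b k a qs g → vol A g (b ∷ replicate k a ++ qs) ≈ vol A g (replicate k a ++ b ∷ qs)
      vol-shift b zero    a qs g = refl
      vol-shift b (suc k) a qs g = trans (vol-swap g b a (replicate k a ++ qs))
        (vol-tail-cong a (b ∷ replicate k a ++ qs) (replicate k a ++ b ∷ qs) (vol-shift b k a qs))

  -- For positive weights every volume of nonzero vectors is positive, so that
  -- the forms below are never degenerate.
  module PositiveWeights (A : Matrix n) (symA : Symmetric A) (0<A : ∀ i j → 0# < A i j)
    (hyperbolicA : Hyperbolic (bil A)) where

    PositiveField : 𝕍 → Set (ℓ₁ ⊔ ℓ₂)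
    PositiveField g = ∀ i → 0# < g i

    extend-positive : ∀ {g} → PositiveField g → ∀ v → PositiveField (λ u → g u * A v u)
    extend-positive 0<g v u = *-pos (0<g u) (0<A v u)

    vol-pos : ∀ {g ps} → PositiveField g → All NonnegNonzero ps → 0# < vol A g ps
    vol-pos 0<g [] = 0<1
    vol-pos {g} {x ∷ ps} 0<g ((0≤x , i , 0<xi) ∷ pps) = sum-pos
      (λ v → *-nonneg (0≤x v) (proj₁ (factor v))) i (*-pos 0<xi (factor i))
      where
      factor : ∀ v → 0# < g v * vol A (λ u → g u * A v u) ps
      factor v = *-pos (0<g v) (vol-pos (extend-positive 0<g v) pps)

    trilinear : ∀ {g ps} → PositiveField g → All NonnegNonzero ps → SymmetricTrilinear
    trilinear {g} {ps} 0<g pps = record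
      { T        = λ x y z → vol A g (x ∷ y ∷ z ∷ ps)
      ; T-cong   = λ y z → vol-head-cong A (y ∷ z ∷ ps)
      ; T-linear = λ s x t y p q → vol-linear A s x t y (p ∷ q ∷ ps)
      ; T-swap₁₂ = λ x y z → vol-swap A symA g x y (z ∷ ps)
      ; T-swap₂₃ = λ x y z → vol-tail-cong A x (y ∷ z ∷ ps) (z ∷ y ∷ ps) λ g → vol-swap A symA g y z ps
      ; T-pos    = λ px py pz → vol-pos 0<g (px ∷ py ∷ pz ∷ pps)
      }

    -- The field must be arbitrary, since placing a vertex at k replaces g by g · A k. With no fixed
    -- vectors the form is `bil A` after multiplying both arguments by g, a substitution that
    -- preserves nonnegativity.
    vol-hyperbolic : ∀ {g ps} → PositiveField g → All NonnegNonzero ps →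
                     Hyperbolic (λ x y → vol A g (x ∷ y ∷ ps))
    vol-hyperbolic {g} 0<g [] = Hyperbolic-resp to-vol
      λ x y 0≤y → hyperbolicA (λ v → g v * x v) (λ v → g v * y v) λ v → *-nonneg (proj₁ (0<g v)) (0≤y v)
      where
      to-vol : ∀ x y → bil A (λ v → g v * x v) (λ v → g v * y v) ≈ vol A g (x ∷ y ∷ [])
      to-vol x y = sum-cong λ v → trans
        (solve 3 (λ g x s → g :* x :* s := x :* (g :* s)) refl (g v) (x v) (dot (A v) (λ w → g w * y w)))
        (*-congˡ (*-congˡ (sum-cong λ w →
          solve 3 (λ a g y → a :* (g :* y) := y :* (g :* a :* con (+ 1))) refl (A v w) (g w) (y w))))
    vol-hyperbolic {g} {p ∷ ps} 0<g (pp ∷ pps) =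
      Hyperbolic-resp (λ x y → trans (T-swap₁₂ p x y) (T-swap₂₃ x p y))
        (Hyperbolic-nonneg vertex (proj₁ pp))
      where
      open SymmetricTrilinear (trilinear 0<g pps)
      vertex : ∀ k → Hyperbolic (T (basis k))
      vertex k = Hyperbolic-resp (λ x y → sym (at-vertex x y))
          (Hyperbolic-scale (g k) (vol-hyperbolic (extend-positive 0<g k) pps))
        where
        at-vertex : ∀ x y → T (basis k) x y ≈ g k * vol A (λ u → g u * A k u) (x ∷ y ∷ ps)
        at-vertex x y = trans (sum-cong λ v → *-congʳ (identity-sym v k)) (dot-identity k _)

    module Powers {a b} (a>0 : NonnegNonzero a) (b>0 : NonnegNonzero b) {g} (0<g : PositiveField g) where

      ab : ℕ → ℕ → List 𝕍
      ab k m = replicate k a ++ replicate m b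

      ab-positive : ∀ k m → All NonnegNonzero (ab k m)
      ab-positive k m = All.++⁺ (All.replicate⁺ k a>0) (All.replicate⁺ m b>0)

      mixed : ℕ → ℕ → Carrier
      mixed k m = vol A g (ab k m)

      0<mixed : ∀ k m → 0# < mixed k m
      0<mixed k m = vol-pos 0<g (ab-positive k m)

      move : ∀ k m h → vol A h (b ∷ ab k m) ≈ vol A h (ab k (suc m))
      move k m = vol-shift A symA b k a (replicate m b)

      log-concave : ∀ k m → mixed (2 ℕ.+ k) m * mixed k (2 ℕ.+ m) ≤ mixed (1 ℕ.+ k) (1 ℕ.+ m) * mixed (1 ℕ.+ k) (1 ℕ.+ m)
      log-concave k m = ≤-resp
        (*-congˡ (trans (vol-tail-cong A b (b ∷ ab k m) (ab k (suc m)) (move k m)) (move k (suc m) g)))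
        (*-cong ab-step ab-step)
        (vol-hyperbolic 0<g (ab-positive k m) a b (proj₁ b>0))
        where
        ab-step : vol A g (a ∷ b ∷ ab k m) ≈ mixed (1 ℕ.+ k) (1 ℕ.+ m)
        ab-step = vol-tail-cong A a (b ∷ ab k m) (ab k (suc m)) (move k m)

      -- Write M_k for the volume with k copies of a and t + 1 - k of b. Log-concavity makes M_(k+1)
      -- / M_k nonincreasing, hence at most M_1 / M_0; this is the cross-multiplied form, and each
      -- step cancels a positive M_k.
      ratio : ∀ {t} k m → k ℕ.+ suc m ≡ suc t → mixed 0 (suc t) * mixed (suc k) m ≤ mixed 1 t * mixed k (suc m)
      ratio zero    m ≡.refl = ≤-reflexive (*-comm _ _)
      ratio {t} (suc k) m e = *-cancelˡ-≤ (0<mixed k (2 ℕ.+ m)) (≤-trans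
        (≤-resp (solve 3 (λ s x y → s :* (x :* y) := y :* (s :* x)) refl (mixed 0 (suc t)) (mixed (2 ℕ.+ k) m) (mixed k (2 ℕ.+ m))) refl
          (*-monoˡ-≤ (proj₁ (0<mixed 0 (suc t))) (log-concave k m)))
        (≤-resp (solve 2 (λ s x → x :* (s :* x) := s :* (x :* x)) refl (mixed 0 (suc t)) (mixed (suc k) (suc m)))
                (solve 3 (λ s x y → x :* (s :* y) := y :* (s :* x)) refl (mixed 1 t) (mixed (suc k) (suc m)) (mixed k (2 ℕ.+ m)))
          (*-monoˡ-≤ (proj₁ (0<mixed (suc k) (suc m)))
            (ratio k (suc m) (≡.trans (ℕₚ.+-suc k (suc m)) e)))))

      -- Compares the last quotient of `ratio` with the first, k = t and m = 0. In each factor the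
      -- odd vector is brought to the front, where `vol` places its vertex first.
      exchange : ∀ t → vol A g (replicate (suc t) a) * vol A g (replicate (suc t) b) ≤
                       vol A g (b ∷ replicate t a) * vol A g (a ∷ replicate t b)
      exchange t = ≤-resp
        (trans (*-comm _ _) (*-congʳ (drop-[] (suc t))))
        (trans (*-comm _ _) (*-congʳ (trans (sym (move t 0 g)) (vol-tail-cong A b (ab t 0) (replicate t a) λ h → drop-[] t))))
        (ratio t 0 (ℕₚ.+-comm t 1))
        where
        drop-[] : ∀ k {h} → vol A h (ab k 0) ≈ vol A h (replicate k a)
        drop-[] k {h} = reflexive (≡.cong (vol A h) (++-identityʳ (replicate k a)))

    vol-vertex : ∀ x t a → vol A unit (x ∷ replicate t a) ≈ sum (λ v → x v * vol A unit (replicate t (λ u → A v u * a u)))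
    vol-vertex x t a = sum-cong λ v → *-congˡ (trans (*-identityˡ _) (vol-field A unit (A v) t a))

    product-of-sums : ∀ {m} (f h : Vector Carrier m) → sum h * sum f ≈ sum (λ u → sum (λ w → f u * h w))
    product-of-sums f h = trans (*-comm _ _) (trans (*-distribʳ-sum (sum h) f)
      (sum-cong λ u → *-distribˡ-sum (f u) h))

    -- After `exchange`, the clique of a-vertices has one vertex w weighted by b, and the other
    -- clique one vertex u weighted by a. Thus u is joined to the remaining b-vertices, w to the
    -- remaining a-vertices, and u and w are not joined: they form a new matched pair of K_t × K_2.
    -- Zero vectors are treated apart because `exchange` needs positive mixed volumes.
    volume-inequality : ∀ t {a b} → Nonneg a → Nonneg b →
      vol A unit (replicate t a) * vol A unit (replicate t b) ≤ bivol A t a b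
    volume-inequality zero    0≤a 0≤b = ≤-reflexive (*-identityˡ 1#)
    volume-inequality (suc t) {a} {b} 0≤a 0≤b with zero⊎nonzero 0≤a | zero⊎nonzero 0≤b
    ... | inj₁ e | _ = ≤-resp (sym (trans (*-congʳ (vol-vanish (replicate t a) e)) (zeroˡ _))) refl
      (bivol-nonneg (λ i j → proj₁ (0<A i j)) (suc t) 0≤a 0≤b)
    ... | inj₂ _ | inj₁ e = ≤-resp (sym (trans (*-congˡ (vol-vanish (replicate t b) e)) (zeroʳ _))) refl
      (bivol-nonneg (λ i j → proj₁ (0<A i j)) (suc t) 0≤a 0≤b)
    ... | inj₂ na | inj₂ nb = ≤-trans (Powers.exchange (0≤a , na) (0≤b , nb) (λ _ → 0<1) t)
      (≤-resp (sym (trans (*-cong (vol-vertex b t a) (vol-vertex a t b))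
                 (product-of-sums (λ u → a u * B u) (λ w → b w * C w))))
              refl
        (sum-mono λ u → sum-mono λ w → ≤-resp
          (solve 4 (λ a b p q → a :* b :* (p :* q) := a :* q :* (b :* p)) refl (a u) (b w) (C w) (B u)) refl
          (*-monoˡ-≤ (*-nonneg (0≤a u) (0≤b w))
            (volume-inequality t (λ v → *-nonneg (proj₁ (0<A w v)) (0≤a v)) (λ v → *-nonneg (proj₁ (0<A u v)) (0≤b v))))))
      where
      B C : 𝕍
      B u = vol A unit (replicate t (λ v → A u v * b v))
      C w = vol A unit (replicate t (λ v → A w v * a v))

-- Reduction to positive weights

module Perturbation {c ℓ₁ ℓ₂} (ℝ : CompleteOrderedField c ℓ₁ ℓ₂) (n : ℕ) where

  open OrderedField ℝ
  open WeightedGraphs ℝ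
  open FiniteSums ℝ
  open SpectralTheory ℝ
  open Hyperbolicity ℝ n
  open Volumes ℝ n

  ≤-limit : ∀ {x y C} → 0# ≤ C → (∀ ε → 0# < ε → ε ≤ 1# → x ≤ y + C * ε) → x ≤ y
  ≤-limit {x} {y} {C} 0≤C h = ≤-by-contradiction λ y<x → let
      d = x - y
      0<d = x<y⇒0<y-x y<x
      0<C+1 = 0<x+y 0<1 0≤C
      0<D = 0<x+y 0<d (proj₁ 0<C+1)
      s , 0<s , Ds≈1 = inverse 0<D
      -- This is d / (d + 1 + C): it is at most 1, and d - C ε = (d + 1) ε is positive, which
      -- contradicts x ≤ y + C ε.
      ε = d * s
      0<ε = *-pos 0<d 0<s
      Dε≈d : (d + (1# + C)) * ε ≈ d
      Dε≈d = trans (solve 3 (λ D d s → D :* (d :* s) := (D :* s) :* d) refl (d + (1# + C)) d s)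
                   (trans (*-congʳ Ds≈1) (*-identityˡ d))
      ε≤1 = *-cancelˡ-≤ 0<D (≤-resp (sym Dε≈d) (sym (*-identityʳ _))
              (≤-cert (solve 2 (λ d k → (d :+ k) :- d := k) refl d (1# + C)) (proj₁ 0<C+1)))
      positive : 0# < (d + 1#) * ε
      positive = *-pos (0<x+y 0<d 0≤1) 0<ε
    in <⇒≱ positive (≤-cert
         (trans (+-congˡ (-‿cong (trans
             (solve 3 (λ d C e → (d :+ con (+ 1)) :* e := (d :+ (con (+ 1) :+ C)) :* e :- C :* e) refl d C ε)
             (+-congʳ Dε≈d))))
           (solve 3 (λ x y k → con (+ 0) :- ((x :- y) :- k) := (y :+ k) :- x) refl x y (C * ε)))
         (x≤y⇒0≤y-x (h ε 0<ε ε≤1)))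

  -- A one-sided substitute for continuity at 0. Nonnegativity makes the estimate stable under
  -- products, and ε ≤ 1 allows their ε² terms to be absorbed into the linear one.
  NearAbove : (Carrier → Carrier) → Carrier → Set (c ⊔ ℓ₂)
  NearAbove f L = 0# ≤ L × ∃ λ C → 0# ≤ C × ∀ ε → 0# ≤ ε → ε ≤ 1# → 0# ≤ f ε × f ε ≤ L + C * ε

  NearAbove-const : ∀ {x} → 0# ≤ x → NearAbove (λ _ → x) x
  NearAbove-const {x} 0≤x = 0≤x , 0# , ≤-refl , λ ε _ _ → 0≤x ,
    ≤-reflexive (sym (trans (+-congˡ (zeroˡ ε)) (+-identityʳ x)))

  NearAbove-+ : ∀ {f g L M} → NearAbove f L → NearAbove g M → NearAbove (λ ε → f ε + g ε) (L + M)
  NearAbove-+ {f} {g} {L} {M} (0≤L , C , 0≤C , hf) (0≤M , D , 0≤D , hg) =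
    +-nonneg 0≤L 0≤M , C + D , +-nonneg 0≤C 0≤D , λ ε 0≤ε ε≤1 → let
        0≤f , f≤ = hf ε 0≤ε ε≤1
        0≤g , g≤ = hg ε 0≤ε ε≤1
      in +-nonneg 0≤f 0≤g , ≤-resp refl
           (solve 5 (λ L M C D e → (L :+ C :* e) :+ (M :+ D :* e) := L :+ M :+ (C :+ D) :* e) refl L M C D ε)
           (+-mono-≤ f≤ g≤)

  NearAbove-* : ∀ {f g L M} → NearAbove f L → NearAbove g M → NearAbove (λ ε → f ε * g ε) (L * M)
  NearAbove-* {f} {g} {L} {M} (0≤L , C , 0≤C , hf) (0≤M , D , 0≤D , hg) =
    *-nonneg 0≤L 0≤M , L * D + C * M + C * D
      , +-nonneg (+-nonneg (*-nonneg 0≤L 0≤D) (*-nonneg 0≤C 0≤M)) (*-nonneg 0≤C 0≤D)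
      , λ ε 0≤ε ε≤1 → let
        0≤f , f≤ = hf ε 0≤ε ε≤1
        0≤g , g≤ = hg ε 0≤ε ε≤1
      in *-nonneg 0≤f 0≤g , ≤-trans (*-mono-≤ 0≤f 0≤g f≤ g≤)
        (≤-cert (solve 5 (λ L M C D e →
            (L :* M :+ (L :* D :+ C :* M :+ C :* D) :* e) :- ((L :+ C :* e) :* (M :+ D :* e))
            := C :* D :* (e :* (con (+ 1) :- e))) refl L M C D ε)
          (*-nonneg (*-nonneg 0≤C 0≤D) (*-nonneg 0≤ε (x≤y⇒0≤y-x ε≤1))))

  NearAbove-sum : ∀ {m} {f : Fin m → Carrier → Carrier} {L : Vector Carrier m} →
                  (∀ i → NearAbove (f i) (L i)) → NearAbove (λ ε → sum (λ i → f i ε)) (sum L)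
  NearAbove-sum {zero}  h = NearAbove-const ≤-refl
  NearAbove-sum {suc m} h = NearAbove-+ (h zero) (NearAbove-sum (h ∘ suc))

  NearAbove-bivol : ∀ {A : Carrier → Matrix n} {A₀ : Matrix n} →
    (∀ i j → NearAbove (λ ε → A ε i j) (A₀ i j)) →
    ∀ t {a b : Carrier → 𝕍} {a₀ b₀ : 𝕍} →
    (∀ i → NearAbove (λ ε → a ε i) (a₀ i)) → (∀ i → NearAbove (λ ε → b ε i) (b₀ i)) →
    NearAbove (λ ε → bivol (A ε) t (a ε) (b ε)) (bivol A₀ t a₀ b₀)
  NearAbove-bivol hA zero    ha hb = NearAbove-const 0≤1
  NearAbove-bivol hA (suc t) ha hb = NearAbove-sum λ u → NearAbove-sum λ w →
    NearAbove-* (NearAbove-* (ha u) (hb w))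
      (NearAbove-bivol hA t (λ v → NearAbove-* (hA w v) (ha v)) (λ v → NearAbove-* (hA u v) (hb v)))

  module _ (A : Matrix n) (symA : Symmetric A) (0≤A : ∀ i j → 0# ≤ A i j) (hyperbolicA : Hyperbolic (bil A)) where

    degree : 𝕍
    degree = A ▷ unit

    mass : Carrier
    mass = dot unit degree

    degree-nonneg : Nonneg degree
    degree-nonneg i = sum-nonneg λ j → *-nonneg (0≤A i j) 0≤1

    mass-nonneg : 0# ≤ mass
    mass-nonneg = sum-nonneg λ i → *-nonneg 0≤1 (degree-nonneg i)

    -- This is (I + εJ) A (I + εJ), where J is the all-ones matrix.
    perturbed : Carrier → Matrix n
    perturbed ε i = combination 1# (A i) ε (combination 1# degree (degree i + ε * mass) unit)

    perturbed-sym : ∀ ε → Symmetric (perturbed ε)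
    perturbed-sym ε i j = +-cong (*-congˡ (symA i j))
      (solve 4 (λ e s x y → e :* (con (+ 1) :* y :+ (x :+ e :* s) :* con (+ 1))
                         := e :* (con (+ 1) :* x :+ (y :+ e :* s) :* con (+ 1)))
        refl ε mass (degree i) (degree j))

    -- Multiplication by I + εJ, the change of variables behind `perturbed`.
    spread : Carrier → 𝕍 → 𝕍
    spread ε x = combination 1# x (ε * dot unit x) unit

    perturbed-bil : ∀ ε x y → bil A (spread ε x) (spread ε y) ≈ bil (perturbed ε) x y
    perturbed-bil ε x y = trans expand-spread (sym expand-perturbed)
      where
      X = dot unit x
      Y = dot unit y
      p = bil A x y
      q = bil A x unit
      r = bil A y unit
      expand-spread : bil A (spread ε x) (spread ε y) ≈ p + ε * Y * q + (ε * X * r + ε * ε * mass * X * Y)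
      expand-spread = begin
        bil A (spread ε x) (spread ε y)
          ≈⟨ bil-combinationʳ A (spread ε x) 1# y (ε * Y) unit ⟩
        1# * bil A (spread ε x) y + ε * Y * bil A (spread ε x) unit
          ≈⟨ +-cong (*-congˡ (trans (bil-sym symA (spread ε x) y) (bil-combinationʳ A y 1# x (ε * X) unit)))
                    (*-congˡ (trans (bil-sym symA (spread ε x) unit) (bil-combinationʳ A unit 1# x (ε * X) unit))) ⟩
        1# * (1# * bil A y x + ε * X * r) + ε * Y * (1# * bil A unit x + ε * X * mass)
          ≈⟨ +-cong (*-congˡ (+-congʳ (*-congˡ (bil-sym symA y x)))) (*-congˡ (+-congʳ (*-congˡ (bil-sym symA unit x)))) ⟩
        1# * (1# * p + ε * X * r) + ε * Y * (1# * q + ε * X * mass)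
          ≈⟨ solve 7 (λ e X Y p q r s → con (+ 1) :* (con (+ 1) :* p :+ e :* X :* r) :+ e :* Y :* (con (+ 1) :* q :+ e :* X :* s)
                := p :+ e :* Y :* q :+ (e :* X :* r :+ e :* e :* s :* X :* Y)) refl ε X Y p q r mass ⟩
        p + ε * Y * q + (ε * X * r + ε * ε * mass * X * Y) ∎
        where open SetoidReasoning setoid
      row : ∀ i → (perturbed ε ▷ y) i ≈
        combination 1# (combination 1# (A ▷ y) (ε * Y) degree) (ε * r + ε * ε * mass * Y) unit i
      row i = begin
        dot (perturbed ε i) y
          ≈⟨ dot-combinationˡ 1# (A i) ε (combination 1# degree (degree i + ε * mass) unit) y ⟩
        1# * dot (A i) y + ε * dot (combination 1# degree (degree i + ε * mass) unit) y
          ≈⟨ +-congˡ (*-congˡ (trans (dot-combinationˡ 1# degree (degree i + ε * mass) unit y)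
               (+-congʳ (*-congˡ (dot-comm degree y))))) ⟩
        1# * dot (A i) y + ε * (1# * r + (degree i + ε * mass) * Y)
          ≈⟨ solve 6 (λ e s Y a d r → con (+ 1) :* a :+ e :* (con (+ 1) :* r :+ (d :+ e :* s) :* Y)
               := con (+ 1) :* (con (+ 1) :* a :+ e :* Y :* d) :+ (e :* r :+ e :* e :* s :* Y) :* con (+ 1))
               refl ε mass Y (dot (A i) y) (degree i) r ⟩
        1# * (1# * dot (A i) y + ε * Y * degree i) + (ε * r + ε * ε * mass * Y) * 1# ∎
        where open SetoidReasoning setoid
      expand-perturbed : bil (perturbed ε) x y ≈ p + ε * Y * q + (ε * X * r + ε * ε * mass * X * Y)
      expand-perturbed = begin
        bil (perturbed ε) x y
          ≈⟨ dot-cong (λ _ → refl) row ⟩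
        dot x (combination 1# (combination 1# (A ▷ y) (ε * Y) degree) (ε * r + ε * ε * mass * Y) unit)
          ≈⟨ dot-combinationʳ x 1# (combination 1# (A ▷ y) (ε * Y) degree) (ε * r + ε * ε * mass * Y) unit ⟩
        1# * dot x (combination 1# (A ▷ y) (ε * Y) degree) + (ε * r + ε * ε * mass * Y) * dot x unit
          ≈⟨ +-cong (*-congˡ (dot-combinationʳ x 1# (A ▷ y) (ε * Y) degree)) (*-congˡ (dot-comm x unit)) ⟩
        1# * (1# * p + ε * Y * q) + (ε * r + ε * ε * mass * Y) * X
          ≈⟨ solve 7 (λ e X Y p q r s → con (+ 1) :* (con (+ 1) :* p :+ e :* Y :* q) :+ (e :* r :+ e :* e :* s :* Y) :* X
                := p :+ e :* Y :* q :+ (e :* X :* r :+ e :* e :* s :* X :* Y)) refl ε X Y p q r mass ⟩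
        p + ε * Y * q + (ε * X * r + ε * ε * mass * X * Y) ∎
        where open SetoidReasoning setoid

    perturbed-hyperbolic : ∀ {ε} → 0# ≤ ε → Hyperbolic (bil (perturbed ε))
    perturbed-hyperbolic {ε} 0≤ε = Hyperbolic-resp (perturbed-bil ε) λ x y 0≤y →
      hyperbolicA (spread ε x) (spread ε y) λ i → +-nonneg (*-nonneg 0≤1 (0≤y i))
        (*-nonneg (*-nonneg 0≤ε (sum-nonneg λ j → *-nonneg 0≤1 (0≤y j))) 0≤1)

    increment-nonneg : ∀ {ε} → 0# ≤ ε → ∀ i j → 0# ≤ 1# * degree j + (degree i + ε * mass) * 1#
    increment-nonneg 0≤ε i j = +-nonneg (*-nonneg 0≤1 (degree-nonneg j))
      (*-nonneg (+-nonneg (degree-nonneg i) (*-nonneg 0≤ε mass-nonneg)) 0≤1)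

    perturbed-≥ : ∀ {ε} → 0# ≤ ε → ∀ i j → A i j ≤ perturbed ε i j
    perturbed-≥ {ε} 0≤ε i j = ≤-cert
      (solve 3 (λ a e d → (con (+ 1) :* a :+ e :* d) :- a := e :* d) refl
        (A i j) ε (1# * degree j + (degree i + ε * mass) * 1#))
      (*-nonneg 0≤ε (increment-nonneg 0≤ε i j))

    -- The contribution ε² J A J has all entries equal to ε² `mass`, so a single positive weight
    -- makes every entry positive.
    perturbed-pos : ∀ {ε} → 0# < mass → 0# < ε → ∀ i j → 0# < perturbed ε i j
    perturbed-pos {ε} 0<mass 0<ε i j = <-resp refl
      (solve 5 (λ e s a x y → e :* (e :* s) :+ (a :+ e :* (y :+ x))
          := con (+ 1) :* a :+ e :* (con (+ 1) :* y :+ (x :+ e :* s) :* con (+ 1)))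
        refl ε mass (A i j) (degree i) (degree j))
      (0<x+y (*-pos 0<ε (*-pos 0<ε 0<mass))
        (+-nonneg (0≤A i j) (*-nonneg (proj₁ 0<ε) (+-nonneg (degree-nonneg j) (degree-nonneg i)))))

    NearAbove-perturbed : ∀ i j → NearAbove (λ ε → perturbed ε i j) (A i j)
    NearAbove-perturbed i j = 0≤A i j , degree j + degree i + mass
      , +-nonneg (+-nonneg (degree-nonneg j) (degree-nonneg i)) mass-nonneg
      , λ ε 0≤ε ε≤1 → ≤-trans (0≤A i j) (perturbed-≥ 0≤ε i j)
        , ≤-cert (solve 5 (λ e s a x y →
              (a :+ (y :+ x :+ s) :* e) :- (con (+ 1) :* a :+ e :* (con (+ 1) :* y :+ (x :+ e :* s) :* con (+ 1)))
              := e :* s :* (con (+ 1) :- e))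
            refl ε mass (A i j) (degree i) (degree j))
          (*-nonneg (*-nonneg 0≤ε mass-nonneg) (x≤y⇒0≤y-x ε≤1))

    edgeless : mass ≈ 0# → ∀ i j → A i j ≈ 0#
    edgeless e i j = antisym (≤-trans
        (≤-resp (*-identityʳ _) (sym (*-identityˡ _)) (term≤sum (λ j → *-nonneg (0≤A i j) 0≤1) j))
        (≤-resp refl e (term≤sum (λ i → *-nonneg 0≤1 (degree-nonneg i)) i)))
      (0≤A i j)

    hyperbolic-volume-inequality : ∀ t {a b} → 2 ℕ.≤ t → Nonneg a → Nonneg b →
      vol A unit (replicate t a) * vol A unit (replicate t b) ≤ bivol A t a b
    hyperbolic-volume-inequality (suc zero) (ℕ.s≤s ())
    hyperbolic-volume-inequality t@(suc (suc s)) {a} {b} _ 0≤a 0≤b =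
      [ edgeless-case , edge-case ]′ (0≤⇒≈0⊎0< mass-nonneg)
      where
      -- Zero weights stay zero under the perturbation, so this case is separate: a clique on at
      -- least two vertices contains an edge, and its volume vanishes.
      edgeless-case : mass ≈ 0# → vol A unit (replicate t a) * vol A unit (replicate t b) ≤ bivol A t a b
      edgeless-case e = ≤-resp
        (sym (trans (*-congʳ (vol-edgeless a a (replicate s a) (edgeless e))) (zeroˡ _))) refl
        (bivol-nonneg 0≤A t 0≤a 0≤b)
      edge-case : 0# < mass → vol A unit (replicate t a) * vol A unit (replicate t b) ≤ bivol A t a b
      edge-case 0<mass = let
          _ , C , 0≤C , near = NearAbove-bivol NearAbove-perturbed t
            (λ i → NearAbove-const (0≤a i)) (λ i → NearAbove-const (0≤b i))
        in ≤-limit 0≤C λ ε 0<ε ε≤1 → ≤-trans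
          (*-mono-≤ (base-nonneg 0≤a) (base-nonneg 0≤b) (mono 0<ε 0≤a) (mono 0<ε 0≤b))
          (≤-trans
            (PositiveWeights.volume-inequality (perturbed ε) (perturbed-sym ε) (perturbed-pos 0<mass 0<ε)
              (perturbed-hyperbolic (proj₁ 0<ε)) t 0≤a 0≤b)
            (proj₂ (near ε (proj₁ 0<ε) ε≤1)))
        where
        base-nonneg : ∀ {x} → Nonneg x → 0# ≤ vol A unit (replicate t x)
        base-nonneg 0≤x = vol-nonneg 0≤A (λ _ → 0≤1) (All.replicate⁺ t 0≤x)
        mono : ∀ {ε x} → 0# < ε → Nonneg x → vol A unit (replicate t x) ≤ vol (perturbed ε) unit (replicate t x)
        mono 0<ε 0≤x = vol-mono 0≤A (perturbed-≥ (proj₁ 0<ε)) (λ _ → 0≤1) (λ _ → ≤-refl) (All.replicate⁺ t 0≤x)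

-- From sums over maps to the recursive volumes

module SumsOverMaps {c ℓ₁ ℓ₂} (ℝ : CompleteOrderedField c ℓ₁ ℓ₂) (n : ℕ) where

  open OrderedField ℝ
  open WeightedGraphs ℝ
  open FiniteSums ℝ
  open SpectralTheory ℝ
  open Hyperbolicity ℝ n
  open Volumes ℝ n
  open FiniteSum *-commutativeMonoid using () renaming (∑-distrib-+ to product-distrib)

  sum-++ : ∀ m {k} (f : Fin (m ℕ.+ k) → Carrier) →
           sum f ≈ sum (λ i → f (i ↑ˡ k)) + sum (λ j → f (m ↑ʳ j))
  sum-++ zero    f = sym (+-identityˡ _)
  sum-++ (suc m) f = trans (+-congˡ (sum-++ m (f ∘ suc))) (sym (+-assoc _ _ _))

  sum-combine : ∀ m {k} (f : Fin (m ℕ.* k) → Carrier) →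
                sum f ≈ sum (λ i → sum (λ j → f (combine {m} {k} i j)))
  sum-combine zero        f = refl
  sum-combine (suc m) {k} f = trans (sum-++ k f) (+-congˡ (sum-combine m (λ i → f (k ↑ʳ i))))

  -- The leading base-n digit of the index is the value at `zero`, and the remaining digits encode
  -- the rest of the map.
  finToFun-combine : ∀ t (v : Fin n) k (i : Fin (suc t)) →
                     finToFun (combine {n} {n ^ t} v k) i ≡ cons v (finToFun k) i
  finToFun-combine t v k zero    = ≡.cong proj₁ (remQuot-combine v k)
  finToFun-combine t v k (suc i) = ≡.cong (λ qr → finToFun (proj₂ qr) i) (remQuot-combine {n} v k)

  -- Decoding an index gives a map that agrees with `cons` only pointwise, so summands have to
  -- respect pointwise equality.
  Extensional : ∀ {t} → ((Fin t → Fin n) → Carrier) → Set ℓ₁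
  Extensional F = ∀ {φ ψ} → (∀ i → φ i ≡ ψ i) → F φ ≈ F ψ

  sumOverMaps-suc : ∀ {t} {F : (Fin (suc t) → Fin n) → Carrier} → Extensional F →
                    sumOverMaps F ≈ sum (λ v → sumOverMaps (λ φ → F (cons v φ)))
  sumOverMaps-suc {t} {F} ext = trans
    (sum-combine n {n ^ t} (λ k → F (finToFun k)))
    (sum-cong λ v → sum-cong λ k → ext (finToFun-combine t v k))

  sumOverMaps-cong : ∀ {t} {F F′ : (Fin t → Fin n) → Carrier} → (∀ φ → F φ ≈ F′ φ) → sumOverMaps F ≈ sumOverMaps F′
  sumOverMaps-cong e = sum-cong λ k → e (finToFun k)

  sumOverMaps-scale : ∀ {t} s (F : (Fin t → Fin n) → Carrier) → sumOverMaps (λ φ → s * F φ) ≈ s * sumOverMaps F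
  sumOverMaps-scale s F = sym (*-distribˡ-sum s (λ k → F (finToFun k)))

  product-cong : ∀ {m} {f g : Vector Carrier m} → (∀ i → f i ≈ g i) → product f ≈ product g
  product-cong {zero}  e = refl
  product-cong {suc m} e = *-cong (e zero) (product-cong (e ∘ suc))

  cons-cong : ∀ {t} {v : Fin n} {φ ψ : Fin t → Fin n} → (∀ i → φ i ≡ ψ i) → ∀ i → cons v φ i ≡ cons v ψ i
  cons-cong e zero    = ≡.refl
  cons-cong e (suc i) = e i

  module _ (A : Matrix n) where

    cliqueWeight : ∀ {t} → (Fin t → Fin n) → Carrier
    cliqueWeight φ = product λ i → product λ j → if does (i <? j) then A (φ i) (φ j) else 1#

    cliqueTerm : ∀ {t} → 𝕍 → 𝕍 → (Fin t → Fin n) → Carrier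
    cliqueTerm g x φ = cliqueWeight φ * product (λ s → g (φ s) * x (φ s))

    cliqueTerm-ext : ∀ {t} g x → Extensional (cliqueTerm {t} g x)
    cliqueTerm-ext {t} g x e = *-cong
      (product-cong {t} λ i → product-cong {t} λ j → reflexive (≡.cong₂ (λ u v → if does (i <? j) then A u v else 1#) (e i) (e j)))
      (product-cong {t} λ s → reflexive (≡.cong (λ u → g u * x u) (e s)))

    cliqueTerm-cons : ∀ {t} g x v (φ : Fin t → Fin n) →
      cliqueTerm g x (cons v φ) ≈ x v * g v * cliqueTerm (λ u → g u * A v u) x φ
    cliqueTerm-cons g x v φ = begin
      -- Row zero has `1#` on the diagonal and then the weights to v; every later row begins with
      -- `1#`, because a pair is counted only at its smaller index.
      1# * P * product (λ i → 1# * N i) * (g v * x v * R)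
        ≈⟨ *-congʳ (*-congˡ (product-cong λ i → *-identityˡ (N i))) ⟩
      1# * P * W * (g v * x v * R)
        ≈⟨ solve 5 (λ p w g x r → con (+ 1) :* p :* w :* (g :* x :* r) := x :* g :* (w :* (p :* r))) refl P W (g v) (x v) R ⟩
      x v * g v * (W * (P * R))
        ≈⟨ *-congˡ (*-congˡ (product-distrib (λ j → A v (φ j)) (λ s → g (φ s) * x (φ s)))) ⟨
      x v * g v * (W * product (λ s → A v (φ s) * (g (φ s) * x (φ s))))
        ≈⟨ *-congˡ (*-congˡ (product-cong λ s →
             solve 3 (λ a g x → a :* (g :* x) := g :* a :* x) refl (A v (φ s)) (g (φ s)) (x (φ s)))) ⟩
      x v * g v * (W * product (λ s → g (φ s) * A v (φ s) * x (φ s))) ∎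
      where
      open SetoidReasoning setoid
      N = λ i → product λ j → if does (i <? j) then A (φ i) (φ j) else 1#
      P = product (λ j → A v (φ j))
      W = product N
      R = product (λ s → g (φ s) * x (φ s))

    sumOverMaps-cliqueTerm : ∀ t g x → sumOverMaps (cliqueTerm {t} g x) ≈ vol A g (replicate t x)
    sumOverMaps-cliqueTerm zero    g x = solve 0 (con (+ 1) :* con (+ 1) :+ con (+ 0) := con (+ 1)) refl
    sumOverMaps-cliqueTerm (suc t) g x = trans (sumOverMaps-suc {t} (cliqueTerm-ext g x)) (sum-cong step)
      where
      step : ∀ v → sumOverMaps {t} (λ φ → cliqueTerm g x (cons v φ)) ≈
                   x v * (g v * vol A (λ u → g u * A v u) (replicate t x))
      step v = trans (sumOverMaps-cong {t} (cliqueTerm-cons g x v))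
        (trans (sumOverMaps-scale {t} (x v * g v) (cliqueTerm (λ u → g u * A v u) x))
        (trans (*-congˡ (sumOverMaps-cliqueTerm t (λ u → g u * A v u) x)) (*-assoc _ _ _)))

    bicliqueWeight : ∀ {t} → (Fin t × Fin 2 → Fin n) → Carrier
    bicliqueWeight φ = product λ i → product λ j →
      if does (i ≟ᶠ j) then 1# else A (φ (i , zero)) (φ (j , suc zero))

    bicliqueTerm : ∀ {t} → 𝕍 → 𝕍 → (Fin (t ℕ.* 2) → Fin n) → Carrier
    bicliqueTerm {t} a b ψ = bicliqueWeight {t} (ψ ∘ uncurry combine) *
      product {t} (λ i → a (ψ (combine i zero)) * b (ψ (combine i (suc zero))))

    bicliqueTerm-ext : ∀ {t} a b → Extensional (bicliqueTerm {t} a b)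
    bicliqueTerm-ext {t} a b e = *-cong
      (product-cong {t} λ i → product-cong {t} λ j → reflexive
        (≡.cong₂ (λ u v → if does (i ≟ᶠ j) then 1# else A u v) (e (combine i zero)) (e (combine j (suc zero)))))
      (product-cong {t} λ i → reflexive (≡.cong₂ (λ u v → a u * b v) (e (combine i zero)) (e (combine i (suc zero)))))

    module _ (symA : Symmetric A) where

      bicliqueTerm-cons : ∀ {t} a b u w (ψ : Fin (t ℕ.* 2) → Fin n) →
        bicliqueTerm {suc t} a b (cons u (cons w ψ)) ≈
        a u * b w * bicliqueTerm {t} (λ v → A w v * a v) (λ v → A u v * b v) ψ
      bicliqueTerm-cons {t} a b u w ψ = begin
        -- Here row zero gives the weights from u to the right vertices, and column zero those from
        -- the left vertices to w. The leading `1#` is the absent edge between u and w.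
        1# * P * product (λ i → A (l i) w * N i) * (a u * b w * R)
          ≈⟨ *-congʳ (*-congˡ (trans (product-cong λ i → *-congʳ (symA (l i) w)) (product-distrib (λ i → A w (l i)) N))) ⟩
        1# * P * (Q * W) * (a u * b w * R)
          ≈⟨ solve 6 (λ p q w a b r → con (+ 1) :* p :* (q :* w) :* (a :* b :* r) := a :* b :* (w :* (p :* q :* r)))
               refl P Q W (a u) (b w) R ⟩
        a u * b w * (W * (P * Q * R))
          ≈⟨ *-congˡ (*-congˡ (trans (product-distrib (λ i → A u (r i) * A w (l i)) (λ i → a (l i) * b (r i)))
               (*-congʳ (product-distrib (λ i → A u (r i)) (λ i → A w (l i)))))) ⟨
        a u * b w * (W * product (λ i → A u (r i) * A w (l i) * (a (l i) * b (r i))))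
          ≈⟨ *-congˡ (*-congˡ (product-cong λ i →
               solve 4 (λ p q a b → p :* q :* (a :* b) := q :* a :* (p :* b)) refl (A u (r i)) (A w (l i)) (a (l i)) (b (r i)))) ⟩
        a u * b w * (W * product (λ i → A w (l i) * a (l i) * (A u (r i) * b (r i)))) ∎
        where
        open SetoidReasoning setoid
        l r : Fin t → Fin n
        l i = ψ (combine i zero)
        r i = ψ (combine i (suc zero))
        N : Fin t → Carrier
        N i = product λ j → if does (i ≟ᶠ j) then 1# else A (l i) (r j)
        P = product (λ j → A u (r j))
        Q = product (λ i → A w (l i))
        W = product N
        R = product (λ i → a (l i) * b (r i))

      -- `combine` numbers the vertex (i, j) as 2 i + j, so the first two positions are the matched
      -- pair with i = 0; splitting off two coordinates removes exactly this pair.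
      sumOverMaps-bicliqueTerm : ∀ t a b → sumOverMaps (bicliqueTerm {t} a b) ≈ bivol A t a b
      sumOverMaps-bicliqueTerm zero    a b = solve 0 (con (+ 1) :* con (+ 1) :+ con (+ 0) := con (+ 1)) refl
      sumOverMaps-bicliqueTerm (suc t) a b = trans
        (sumOverMaps-suc {suc (t ℕ.* 2)} (bicliqueTerm-ext {suc t} a b))
        (sum-cong λ u → trans
          (sumOverMaps-suc {t ℕ.* 2} λ e → bicliqueTerm-ext {suc t} a b (cons-cong e))
          (sum-cong (step u)))
        where
        step : ∀ u w → sumOverMaps {t ℕ.* 2} (λ ψ → bicliqueTerm {suc t} a b (cons u (cons w ψ))) ≈
                       a u * b w * bivol A t (λ v → A w v * a v) (λ v → A u v * b v)
        step u w = trans (sumOverMaps-cong {t ℕ.* 2} (bicliqueTerm-cons {t} a b u w))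
          (trans (sumOverMaps-scale {t ℕ.* 2} (a u * b w) (bicliqueTerm {t} (λ v → A w v * a v) (λ v → A u v * b v)))
                 (*-congˡ (sumOverMaps-bicliqueTerm t (λ v → A w v * a v) (λ v → A u v * b v))))

  V-K≈vol : ∀ t G x → V-K t G x ≈ vol (weight G) unit (replicate t x)
  V-K≈vol t G x = trans
    (sumOverMaps-cong {t} λ φ → *-congˡ {cliqueWeight (weight G) φ} (product-cong {t} λ s → sym (*-identityˡ (x (φ s)))))
    (sumOverMaps-cliqueTerm (weight G) t unit x)

  V-K×K₂≈bivol : ∀ t G a b → V-K×K₂ t G a b ≈ bivol (weight G) t a b
  V-K×K₂≈bivol t G a b = sumOverMaps-bicliqueTerm (weight G) (symmetric G) t a b

theorem4p3 :
    ∀ {c ℓ₁ ℓ₂ : Level} (ℝ : CompleteOrderedField c ℓ₁ ℓ₂) →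
    let open CompleteOrderedField ℝ
        open WeightedGraphs ℝ
    in
    ∀ (n t : ℕ) (G : WeightedGraph n) → Antiferromagnetic G → 2 ℕ.≤ t →
    ∀ (a b : Vector Carrier n) → (∀ i → 0# ≤ a i) → (∀ i → 0# ≤ b i) →
    V-K t G a * V-K t G b ≤ V-K×K₂ t G a b
theorem4p3 ℝ n t G antiferromagnetic 2≤t a b 0≤a 0≤b =
  ≤-resp (sym (*-cong (V-K≈vol t G a) (V-K≈vol t G b))) (sym (V-K×K₂≈bivol t G a b))
    (hyperbolic-volume-inequality (weight G) (symmetric G) (nonneg G)
      -- The form is nonnegative at y because both y and the weights are nonnegative.
      (λ x y 0≤y → reverse-cauchy-schwarz (symmetric G) antiferromagnetic x y
        (sum-nonneg λ i → *-nonneg (0≤y i) (sum-nonneg λ j → *-nonneg (nonneg G i j) (0≤y j))))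
      t 2≤t 0≤a 0≤b)
  where
  open OrderedField ℝ
  open WeightedGraphs ℝ
  open FiniteSums ℝ
  open SpectralTheory ℝ
  open Perturbation ℝ n
  open SumsOverMaps ℝ n
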